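{- Let $a$ and $b$ be positive integers. If $a,b\geq 2$ and $a+b\geq 12$, then $$\mathrm{pp}(a)\,\mathrm{pp}(b) > \mathrm{pp}(a+b).$$ Moreover, the equality $\mathrm{pp}(a)\,\mathrm{pp}(b)=\mathrm{pp}(a+b)$ never holds for positive integers $a,b$.
   Context: A plane partition of a non-negative integer $n$ is an array $\pi=(\pi_{ij})_{i,j\geq 1}$ of non-negative integers with $\sum_{i,j\ge 1}\pi_{ij}=n$ that is weakly decreasing along rows and columns. $\mathrm{pp}(n)$ denotes the number of plane partitions of $n$, with $\mathrm{pp}(0)=1$. By MacMahon's theorem, $\sum_{n\ge 0}\mathrm{pp}(n)q^n=\prod_{n\ge1}(1-q^n)^{ -n}$; equivalently $n\,\mathrm{pp}(n)=\sum_{k=1}^n\sigma_2(k)\,\mathrm{pp}(n-k)$ for $n\ge 1$, where $\sigma_2(k)=\sum_{d\mid k}d^2$. -}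

module Defs where

open import Level using (0ℓ)
open import Data.Fin.Base as Fin using (Fin; toℕ)
open import Data.Fin.Properties using (toℕ<n)
open import Data.List.Base as List
  using (List; []; _∷_; applyUpTo; upTo; filter; length; cartesianProductWith)
open import Data.List.Membership.Propositional using (_∈_)
open import Data.List.Membership.Propositional.Properties
  using (∈-upTo⁺; ∈-filter⁺; ∈-filter⁻; ∈-lookup; ∈-cartesianProductWith⁺)
open import Data.List.Relation.Unary.All as All using ([]; _∷_)
open import Data.List.Relation.Unary.AllPairs using ([]; _∷_)
open import Data.List.Relation.Unary.Any as Any using (here; there)
open import Data.List.Relation.Unary.Any.Properties using (lookup-index)
open import Data.List.Relation.Unary.Unique.Propositional using (Unique)
import Data.List.Relation.Unary.Unique.Propositional.Properties as Unique
open import Data.Nat.Base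
open import Data.Nat.ListAction using (sum)
open import Data.Nat.Properties
open import Data.Product.Base using (_×_; _,_; proj₁; proj₂; ∃-syntax)
open import Data.Sum.Base using (_⊎_; inj₁; inj₂)
open import Data.Vec.Base as Vec using (Vec; []; _∷_; tabulate; replicate)
open import Data.Vec.Properties using (tabulate-cong; ∷-injective)
open import Function.Base using (_∘_)
open import Function.Bundles using (Inverse)
open import Relation.Binary.Bundles using (Setoid)
open import Relation.Binary.PropositionalEquality
open import Relation.Nullary.Decidable using (Dec; yes; no; _×-dec_)
open import Relation.Nullary.Negation using (contradiction)

-- Indices start at 0 instead of 1.
Array : Set
Array = ℕ → ℕ → ℕ

Σ< : ℕ → (ℕ → ℕ) → ℕ
Σ< N f = sum (applyUpTo f N)

boxSum : Array → ℕ → ℕ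
boxSum π N = Σ< N (λ i → Σ< N (π i))

-- The sum of the entries is the limit of the sums over N × N boxes. The limit
-- is taken in ℕ, so it exists exactly when these sums are eventually constant.
HasSum : Array → ℕ → Set
HasSum π n = ∃[ N ] (∀ M → N ≤ M → boxSum π M ≡ n)

record PlanePartition (n : ℕ) : Set where
  field
    π          : Array
    row-weakly : ∀ i j → π i (suc j) ≤ π i j
    col-weakly : ∀ i j → π (suc i) j ≤ π i j
    has-sum    : HasSum π n

open PlanePartition

-- Plane partitions are identified when their entries agree; the proof fields
-- do not matter.
planePartitions : ℕ → Setoid 0ℓ 0ℓ
planePartitions n = record
  { Carrier       = PlanePartition n
  ; _≈_           = λ p q → ∀ i j → π p i j ≡ π q i j
  ; isEquivalence = record
    { refl  = λ _ _ → refl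
    ; sym   = λ e i j → sym (e i j)
    ; trans = λ e f i j → trans (e i j) (f i j)
    }
  }

-- To count the plane partitions of n, note that they vanish outside the n × n
-- box and have entries at most n. So pp n counts the n × n matrices with
-- entries in {0, …, n} whose extension by zero satisfies the conditions below;
-- pp-counts shows that these correspond to the plane partitions of n.

vectors : {A : Set} → List A → (m : ℕ) → List (Vec A m)
vectors xs zero    = [] ∷ []
vectors xs (suc m) = cartesianProductWith _∷_ xs (vectors xs m)

extend : {A : Set} {m : ℕ} → A → Vec A m → ℕ → A
extend d []       _       = d
extend d (x ∷ _)  zero    = x
extend d (_ ∷ xs) (suc i) = extend d xs i

Matrix : ℕ → Set
Matrix n = Vec (Vec ℕ n) n

toArray : {n : ℕ} → Matrix n → Array
toArray {n} m i j = extend 0 (extend (replicate n 0) m i) j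

matrices : (n : ℕ) → List (Matrix n)
matrices n = vectors (vectors (upTo (suc n)) n) n

Fits : (n : ℕ) → Array → Set
Fits n π = (∀ {i} → i < n → ∀ {j} → j < n →
              π i (suc j) ≤ π i j × π (suc i) j ≤ π i j)
           × boxSum π n ≡ n

fits? : ∀ n π → Dec (Fits n π)
fits? n π =
  allUpTo? (λ i → allUpTo? (λ j → (π i (suc j) ≤? π i j)
                                  ×-dec (π (suc i) j ≤? π i j)) n) n
  ×-dec (boxSum π n ≟ n)

fitting : (n : ℕ) → List (Matrix n)
fitting n = filter (fits? n ∘ toArray) (matrices n)

-- Opaque so that type checking does not run the enumeration.
opaque
  pp : ℕ → ℕ
  pp n = length (fitting n)

private
  Σ-cong : ∀ N {f g : ℕ → ℕ} → (∀ {i} → i < N → f i ≡ g i) → Σ< N f ≡ Σ< N g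
  Σ-cong zero    e = refl
  Σ-cong (suc N) e = cong₂ _+_ (e z<s) (Σ-cong N (e ∘ s<s))

  Σ-zero : ∀ N {f : ℕ → ℕ} → (∀ i → f i ≡ 0) → Σ< N f ≡ 0
  Σ-zero zero    e = refl
  Σ-zero (suc N) e = cong₂ _+_ (e 0) (Σ-zero N (e ∘ suc))

  Σ-support : ∀ {N M} {f : ℕ → ℕ} → N ≤ M → (∀ i → N ≤ i → f i ≡ 0) →
              Σ< M f ≡ Σ< N f
  Σ-support {M = M} z≤n     e = Σ-zero M (λ i → e i z≤n)
  Σ-support {f = f} (s≤s N≤M) e =
    cong (f 0 +_) (Σ-support N≤M (λ i → e (suc i) ∘ s≤s))

  Σ-term : ∀ {N i} (f : ℕ → ℕ) → i < N → f i ≤ Σ< N f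
  Σ-term {suc N} {zero}  f _         = m≤m+n _ _
  Σ-term {suc N} {suc i} f (s≤s i<N) =
    ≤-trans (Σ-term (f ∘ suc) i<N) (m≤n+m _ (f 0))

  Σ-positive : ∀ {N M} (f : ℕ → ℕ) → N ≤ M → (∀ {i} → i < N → 1 ≤ f i) →
               N ≤ Σ< M f
  Σ-positive f z≤n       p = z≤n
  Σ-positive f (s≤s N≤M) p = +-mono-≤ (p z<s) (Σ-positive (f ∘ suc) N≤M (p ∘ s<s))

  boxSum-cong : ∀ N {π ρ : Array} → (∀ {i j} → i < N → j < N → π i j ≡ ρ i j) →
                boxSum π N ≡ boxSum ρ N
  boxSum-cong N e = Σ-cong N (λ i<N → Σ-cong N (e i<N))

  boxSum-support : ∀ {N M} {π : Array} → N ≤ M →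
                   (∀ i j → N ≤ i ⊎ N ≤ j → π i j ≡ 0) →
                   boxSum π M ≡ boxSum π N
  boxSum-support {N} {M} {π} N≤M e = trans
    (Σ-support N≤M (λ i N≤i → Σ-zero M (λ j → e i j (inj₁ N≤i))))
    (Σ-cong N (λ {i} _ → Σ-support N≤M (λ j N≤j → e i j (inj₂ N≤j))))

  antitone : ∀ {f : ℕ → ℕ} → (∀ i → f (suc i) ≤ f i) → ∀ {i k} → i ≤′ k → f k ≤ f i
  antitone d ≤′-refl       = ≤-refl
  antitone d (≤′-step i≤k) = ≤-trans (d _) (antitone d i≤k)

  module Bounds {n} (p : PlanePartition n) where

    private
      size : ℕ → ℕ → ℕ
      size i j = proj₁ (has-sum p) ⊔ (suc i ⊔ suc j)

      i<size : ∀ i j → i < size i j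
      i<size i j = ≤-trans (m≤m⊔n (suc i) (suc j)) (m≤n⊔m (proj₁ (has-sum p)) _)

      j<size : ∀ i j → j < size i j
      j<size i j = ≤-trans (m≤n⊔m (suc i) (suc j)) (m≤n⊔m (proj₁ (has-sum p)) _)

      total : ∀ i j → boxSum (π p) (size i j) ≡ n
      total i j = proj₂ (has-sum p) (size i j) (m≤m⊔n _ _)

      row : ℕ → ℕ → ℕ → ℕ
      row i j k = Σ< (size i j) (π p k)

    entry≤n : ∀ i j → π p i j ≤ n
    entry≤n i j = begin
      π p i j                 ≤⟨ Σ-term (π p i) (j<size i j) ⟩
      row i j i               ≤⟨ Σ-term (row i j) (i<size i j) ⟩
      boxSum (π p) (size i j) ≡⟨ total i j ⟩
      n                       ∎
      where open ≤-Reasoning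

    positive⇒i<n : ∀ i j → 1 ≤ π p i j → i < n
    positive⇒i<n i j 1≤π = begin
      suc i                   ≤⟨ Σ-positive (row i j) (i<size i j) row≥1 ⟩
      boxSum (π p) (size i j) ≡⟨ total i j ⟩
      n                       ∎
      where
      open ≤-Reasoning
      row≥1 : ∀ {k} → k < suc i → 1 ≤ row i j k
      row≥1 {k} (s≤s k≤i) = begin
        1         ≤⟨ 1≤π ⟩
        π p i j   ≤⟨ antitone (λ l → col-weakly p l j) (≤⇒≤′ k≤i) ⟩
        π p k j   ≤⟨ Σ-term (π p k) (j<size i j) ⟩
        row i j k ∎

    positive⇒j<n : ∀ i j → 1 ≤ π p i j → j < n
    positive⇒j<n i j 1≤π = begin
      suc j                   ≤⟨ Σ-positive (π p i) (j<size i j) entry≥1 ⟩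
      row i j i               ≤⟨ Σ-term (row i j) (i<size i j) ⟩
      boxSum (π p) (size i j) ≡⟨ total i j ⟩
      n                       ∎
      where
      open ≤-Reasoning
      entry≥1 : ∀ {l} → l < suc j → 1 ≤ π p i l
      entry≥1 (s≤s l≤j) = ≤-trans 1≤π (antitone (row-weakly p i) (≤⇒≤′ l≤j))

    vanishes : ∀ i j → n ≤ i ⊎ n ≤ j → π p i j ≡ 0
    vanishes i j (inj₁ n≤i) = n<1⇒n≡0 (≰⇒> λ 1≤π → <⇒≱ (positive⇒i<n i j 1≤π) n≤i)
    vanishes i j (inj₂ n≤j) = n<1⇒n≡0 (≰⇒> λ 1≤π → <⇒≱ (positive⇒j<n i j 1≤π) n≤j)

    boxSum≡n : boxSum (π p) n ≡ n
    boxSum≡n = trans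
      (sym (boxSum-support (m≤n⊔m (proj₁ (has-sum p)) n) vanishes))
      (proj₂ (has-sum p) _ (m≤m⊔n _ n))

  extend-out : ∀ {A : Set} {m} (d : A) (v : Vec A m) {i} → m ≤ i → extend d v i ≡ d
  extend-out d []      _         = refl
  extend-out d (_ ∷ v) (s≤s m≤i) = extend-out d v m≤i

  extend-tabulate : ∀ {A : Set} {m} (d : A) (f : ℕ → A) {i} → i < m →
                    extend d (tabulate {n = m} (f ∘ toℕ)) i ≡ f i
  extend-tabulate {m = suc m} d f {zero}  _         = refl
  extend-tabulate {m = suc m} d f {suc i} (s≤s i<m) = extend-tabulate d (f ∘ suc) i<m

  tabulate-extend : ∀ {A : Set} {m} (d : A) (v : Vec A m) →
                    tabulate (λ k → extend d v (toℕ k)) ≡ v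
  tabulate-extend d []      = refl
  tabulate-extend d (x ∷ v) = cong (x ∷_) (tabulate-extend d v)

  extend-replicate : ∀ m j → extend 0 (replicate m 0) j ≡ 0
  extend-replicate zero    j       = refl
  extend-replicate (suc m) zero    = refl
  extend-replicate (suc m) (suc j) = extend-replicate m j

  fromArray : ∀ n → Array → Matrix n
  fromArray n π = tabulate (λ i → tabulate (λ j → π (toℕ i) (toℕ j)))

  fromArray-cong : ∀ n {π ρ : Array} → (∀ i j → π i j ≡ ρ i j) →
                   fromArray n π ≡ fromArray n ρ
  fromArray-cong n e = tabulate-cong (λ i → tabulate-cong (λ j → e (toℕ i) (toℕ j)))

  fromArray-toArray : ∀ {n} (m : Matrix n) → fromArray n (toArray m) ≡ m
  fromArray-toArray {n} m = trans
    (tabulate-cong (λ i → tabulate-extend 0 (extend (replicate n 0) m (toℕ i))))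
    (tabulate-extend (replicate n 0) m)

  toArray-out : ∀ {n} (m : Matrix n) i j → n ≤ i ⊎ n ≤ j → toArray m i j ≡ 0
  toArray-out {n} m i j (inj₁ n≤i) = trans
    (cong (λ v → extend 0 v j) (extend-out (replicate n 0) m n≤i))
    (extend-replicate n j)
  toArray-out {n} m i j (inj₂ n≤j) = extend-out 0 (extend (replicate n 0) m i) n≤j

  toArray-fromArray-in : ∀ n (π : Array) {i j} → i < n → j < n →
                         toArray (fromArray n π) i j ≡ π i j
  toArray-fromArray-in n π {i} {j} i<n j<n = trans
    (cong (λ v → extend 0 v j)
          (extend-tabulate (replicate n 0) (λ i → tabulate (λ j → π i (toℕ j))) i<n))
    (extend-tabulate 0 (π i) j<n)

  toArray-fromArray : ∀ {n} (p : PlanePartition n) i j →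
                      toArray (fromArray n (π p)) i j ≡ π p i j
  toArray-fromArray {n} p i j with i <? n | j <? n
  ... | yes i<n | yes j<n = toArray-fromArray-in n (π p) i<n j<n
  ... | no  i≮n | _       =
    trans (toArray-out (fromArray n (π p)) i j (inj₁ (≮⇒≥ i≮n)))
          (sym (Bounds.vanishes p i j (inj₁ (≮⇒≥ i≮n))))
  ... | yes _   | no  j≮n =
    trans (toArray-out (fromArray n (π p)) i j (inj₂ (≮⇒≥ j≮n)))
          (sym (Bounds.vanishes p i j (inj₂ (≮⇒≥ j≮n))))

  vectors-complete : ∀ {A : Set} {xs : List A} m (f : Fin m → A) →
                     (∀ i → f i ∈ xs) → tabulate f ∈ vectors xs m
  vectors-complete zero    f f∈ = here refl
  vectors-complete (suc m) f f∈ = ∈-cartesianProductWith⁺ _∷_ (f∈ Fin.zero)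
    (vectors-complete m (f ∘ Fin.suc) (f∈ ∘ Fin.suc))

  vectors-unique : ∀ {A : Set} {xs : List A} m → Unique xs → Unique (vectors xs m)
  vectors-unique zero    xs! = [] ∷ []
  vectors-unique (suc m) xs! =
    Unique.cartesianProductWith⁺ _∷_ ∷-injective xs! (vectors-unique m xs!)

  lookup-injective : ∀ {A : Set} {xs : List A} → Unique xs → ∀ i j →
                     List.lookup xs i ≡ List.lookup xs j → i ≡ j
  lookup-injective (x∉ ∷ _) Fin.zero    Fin.zero    e = refl
  lookup-injective (x∉ ∷ _) Fin.zero    (Fin.suc j) e =
    contradiction e (All.lookup x∉ (∈-lookup j))
  lookup-injective (x∉ ∷ _) (Fin.suc i) Fin.zero    e =
    contradiction (sym e) (All.lookup x∉ (∈-lookup i))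
  lookup-injective (_ ∷ u)  (Fin.suc i) (Fin.suc j) e =
    cong Fin.suc (lookup-injective u i j e)

  fitting-unique : ∀ n → Unique (fitting n)
  fitting-unique n = Unique.filter⁺ (fits? n ∘ toArray)
    (vectors-unique n (vectors-unique n (Unique.upTo⁺ (suc n))))

  fitting-complete : ∀ {n} (p : PlanePartition n) → fromArray n (π p) ∈ fitting n
  fitting-complete {n} p = ∈-filter⁺ (fits? n ∘ toArray)
    (vectors-complete n _ λ i → vectors-complete n _ λ j →
      ∈-upTo⁺ (s≤s (Bounds.entry≤n p (toℕ i) (toℕ j))))
    ( (λ {i} _ {j} _ →
          subst₂ _≤_ (sym (same i (suc j))) (sym (same i j)) (row-weakly p i j)
        , subst₂ _≤_ (sym (same (suc i) j)) (sym (same i j)) (col-weakly p i j))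
    , trans (boxSum-cong n (λ {i} {j} _ _ → same i j)) (Bounds.boxSum≡n p))
    where
    same : ∀ i j → toArray (fromArray n (π p)) i j ≡ π p i j
    same = toArray-fromArray p

  toPlanePartition : ∀ {n} (m : Matrix n) → Fits n (toArray m) → PlanePartition n
  toPlanePartition {n} m (decreasing , total) = record
    { π          = toArray m
    ; row-weakly = rows
    ; col-weakly = cols
    ; has-sum    = n , λ M n≤M → trans (boxSum-support n≤M (toArray-out m)) total
    }
    where
    rows : ∀ i j → toArray m i (suc j) ≤ toArray m i j
    rows i j with i <? n | j <? n
    ... | yes i<n | yes j<n = proj₁ (decreasing i<n j<n)
    ... | no  i≮n | _       =
      ≤-trans (≤-reflexive (toArray-out m i (suc j) (inj₁ (≮⇒≥ i≮n)))) z≤n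
    ... | yes _   | no  j≮n =
      ≤-trans (≤-reflexive (toArray-out m i (suc j) (inj₂ (m≤n⇒m≤1+n (≮⇒≥ j≮n))))) z≤n
    cols : ∀ i j → toArray m (suc i) j ≤ toArray m i j
    cols i j with i <? n | j <? n
    ... | yes i<n | yes j<n = proj₂ (decreasing i<n j<n)
    ... | no  i≮n | _       =
      ≤-trans (≤-reflexive (toArray-out m (suc i) j (inj₁ (m≤n⇒m≤1+n (≮⇒≥ i≮n))))) z≤n
    ... | yes _   | no  j≮n =
      ≤-trans (≤-reflexive (toArray-out m (suc i) j (inj₂ (≮⇒≥ j≮n)))) z≤n

opaque
  unfolding pp

  pp-counts : ∀ n → Inverse (setoid (Fin (pp n))) (planePartitions n)
  pp-counts n = record
    { to        = to
    ; from      = from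
    ; to-cong   = λ { refl _ _ → refl }
    ; from-cong = λ {p} {q} → from-cong p q
    ; inverse   = (λ { {p} refl → to-from p })
                , (λ {k} {p} e → trans (from-cong p (to k) e) (from-to k))
    }
    where
    open Setoid (planePartitions n) using (_≈_)

    to : Fin (pp n) → PlanePartition n
    to k = toPlanePartition (List.lookup (fitting n) k)
      (proj₂ (∈-filter⁻ (fits? n ∘ toArray) {xs = matrices n} (∈-lookup k)))

    from : PlanePartition n → Fin (pp n)
    from p = Any.index (fitting-complete p)

    lookup-from : ∀ p → fromArray n (π p) ≡ List.lookup (fitting n) (from p)
    lookup-from p = lookup-index (fitting-complete p)

    from-cong : ∀ p q → p ≈ q → from p ≡ from q
    from-cong p q e = lookup-injective (fitting-unique n) (from p) (from q)
      (trans (sym (lookup-from p)) (trans (fromArray-cong n e) (lookup-from q)))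

    to-from : ∀ p → to (from p) ≈ p
    to-from p i j = trans
      (cong (λ m → toArray m i j) (sym (lookup-from p)))
      (toArray-fromArray p i j)

    from-to : ∀ k → from (to k) ≡ k
    from-to k = lookup-injective (fitting-unique n) (from (to k)) k
      (trans (sym (lookup-from (to k))) (fromArray-toArray (List.lookup (fitting n) k)))

{-# OPTIONS --safe #-}

-- MacMahon's formula is proved by sorting paths of interlacing partitions. The
-- diagonals of a plane partition inside an N × N box grow N times and then
-- shrink N times. Exchanging a growing step with the following shrinking step
-- splits off a free natural number m (the local rule of Robinson-Schensted-Knuth)
-- of weight the sum of the two step weights; after all N² exchanges only the
-- empty path is left. This yields ∏ 1 / (1 - q^(i+j+1)) over i, j < N, whose
-- logarithmic derivative is the recurrence n pp(n) = ∑ σ₂(k) pp(n - k).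
--
-- For b ≤ a, expand (a + b) pp(a + b) by this recurrence. In the terms k ≤ a,
-- induction bounds pp(a - k + b) by pp(a - k) pp(b) up to finitely many defects,
-- so these terms give at most a pp(a) pp(b) plus the defects; the terms k > a and
-- the defects are cubic in a, while pp(a) grows faster, and so they are less than
-- b pp(a) pp(b). The cases a < 30 are checked on the values of pp below 60.

module Submission where

open import Defs
open import Data.Empty using (⊥-elim)
open import Data.Fin.Base as Fin using (Fin)
open import Data.Fin.Permutation using (↔⇒≡)
open import Data.Fin.Properties using (+↔⊎; *↔×; injective⇒≤)
open import Data.List.Base using (List; []; _∷_; _++_)
open import Data.Nat
open import Data.Nat.Divisibility
open import Data.Nat.DivMod using (m*n/n≡m)
open import Data.Nat.Properties
open import Data.Nat.Tactic.RingSolver using (solve-∀)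
open import Data.Product using (Σ; _×_; _,_; proj₁; proj₂)
open import Data.Product.Function.NonDependent.Propositional using (_×-↔_)
open import Data.Sum using (_⊎_; inj₁; inj₂)
open import Data.Sum.Function.Propositional using (_⊎-↔_)
open import Data.Unit using (⊤; tt)
open import Data.Vec.Base using (Vec; []; _∷_; head; sum; replicate)
open import Function.Base using (_∘_)
open import Function.Bundles using (Inverse; _↔_; mk↔ₛ′)
import Function.Construct.Composition as Composition
import Function.Construct.Symmetry as Symmetry
open import Function.Properties.Inverse using (↔-sym; ↔-trans)
open import Relation.Binary.PropositionalEquality
open import Relation.Nullary using (¬_; yes; no; contradiction)
open import Relation.Nullary.Decidable using (from-yes; _→-dec_; ¬?)

-- Convolution and the logarithmic derivative of a product

-- No infinite product or subtraction of series occurs. A box with `N ≥ n` already holds every plane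
-- partition of n, so the recurrence at n needs only the factors of one finite box. Division by 1 -
-- q^w becomes an equation f = g + q^w f, which has a single solution.
--
-- The induction cannot use submultiplicativity alone: pp(i + b) exceeds pp(i) pp(b) at i = 1 and at
-- small pairs such as (2, 9), where 859 > 3 · 282 = 846. Hence the defects. For b ≤ a every σ₂(k)
-- in the recurrence is at most (2a)³; it multiplies defects of total at most 20 b pp(b) in the
-- terms k ≤ a, and values of pp of total at most b pp(b) in the terms k > a. So 21 · 8a³ = 168 a³ <
-- pp(a) suffices. The bound 168 (n + 1)³ < pp(n) fails at n = 29 (4536000 against 3759612) and
-- holds at n = 30, and 8 pp(m) ≤ pp(2m) carries it from 30, ..., 59 to all larger n. This fixes
-- both the range of the finite check and the length of the table.

conv : (ℕ → ℕ) → (ℕ → ℕ) → ℕ → ℕ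
conv f g zero    = f 0 * g 0
conv f g (suc n) = f 0 * g (suc n) + conv (f ∘ suc) g n

conv-congʳ : ∀ f {g h} → g ≗ h → conv f g ≗ conv f h
conv-congʳ f e zero    = cong (f 0 *_) (e 0)
conv-congʳ f e (suc n) = cong₂ _+_ (cong (f 0 *_) (e (suc n))) (conv-congʳ (f ∘ suc) e n)

conv-congˡ : ∀ {f g} h → f ≗ g → conv f h ≗ conv g h
conv-congˡ h e zero    = cong (_* h 0) (e 0)
conv-congˡ h e (suc n) = cong₂ _+_ (cong (_* h (suc n)) (e 0)) (conv-congˡ h (e ∘ suc) n)

conv-+ʳ : ∀ f g h n → conv f (λ i → g i + h i) n ≡ conv f g n + conv f h n
conv-+ʳ f g h zero    = *-distribˡ-+ (f 0) _ _
conv-+ʳ f g h (suc n) = trans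
  (cong (f 0 * (g (suc n) + h (suc n)) +_) (conv-+ʳ (f ∘ suc) g h n))
  (lemma (f 0) (g (suc n)) (h (suc n)) _ _)
  where
  lemma : ∀ a b c x y → a * (b + c) + (x + y) ≡ a * b + x + (a * c + y)
  lemma = solve-∀

conv-+ˡ : ∀ f g h n → conv (λ i → f i + g i) h n ≡ conv f h n + conv g h n
conv-+ˡ f g h zero    = *-distribʳ-+ (h 0) (f 0) _
conv-+ˡ f g h (suc n) = trans
  (cong ((f 0 + g 0) * h (suc n) +_) (conv-+ˡ (f ∘ suc) (g ∘ suc) h n))
  (lemma (f 0) (g 0) (h (suc n)) _ _)
  where
  lemma : ∀ a b c x y → (a + b) * c + (x + y) ≡ a * c + x + (b * c + y)
  lemma = solve-∀

conv-*ˡ : ∀ c f g n → conv (λ i → c * f i) g n ≡ c * conv f g n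
conv-*ˡ c f g zero    = *-assoc c _ _
conv-*ˡ c f g (suc n) = trans
  (cong₂ _+_ (*-assoc c (f 0) _) (conv-*ˡ c (f ∘ suc) g n))
  (sym (*-distribˡ-+ c _ _))

conv-*ʳ : ∀ c f g n → conv f (λ i → g i * c) n ≡ conv f g n * c
conv-*ʳ c f g zero    = sym (*-assoc (f 0) _ c)
conv-*ʳ c f g (suc n) = trans
  (cong₂ _+_ (sym (*-assoc (f 0) _ c)) (conv-*ʳ c (f ∘ suc) g n))
  (sym (*-distribʳ-+ c (f 0 * g (suc n)) _))

conv-zeroˡ : ∀ g n → conv (λ _ → 0) g n ≡ 0
conv-zeroˡ g zero    = refl
conv-zeroˡ g (suc n) = conv-zeroˡ g n

conv-monoʳ : ∀ f {g h} n → (∀ {i} → i ≤ n → g i ≤ h i) → conv f g n ≤ conv f h n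
conv-monoʳ f zero    g≤h = *-monoʳ-≤ (f 0) (g≤h z≤n)
conv-monoʳ f (suc n) g≤h = +-mono-≤ (*-monoʳ-≤ (f 0) (g≤h ≤-refl))
  (conv-monoʳ (f ∘ suc) n (g≤h ∘ m≤n⇒m≤1+n))

-- The index of `f` is at most `a` in the first sum and greater in the second. With `σ₂` and `pp`
-- this cuts the recurrence into a main part and a tail.
conv-split : ∀ f g a b → conv f g (a + suc b) ≡
             conv f (λ i → g (i + suc b)) a + conv (λ j → f (suc (a + j))) g b
conv-split f g zero    b = refl
conv-split f g (suc a) b = trans
  (cong (f 0 * g (suc a + suc b) +_) (conv-split (f ∘ suc) g a b))
  (sym (+-assoc (f 0 * g (suc a + suc b)) _ _))

δ : ℕ → ℕ
δ zero    = 1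
δ (suc _) = 0

conv-identityˡ : ∀ g → conv δ g ≗ g
conv-identityˡ g zero    = +-identityʳ _
conv-identityˡ g (suc n) =
  trans (cong₂ _+_ (+-identityʳ _) (conv-zeroˡ g n)) (+-identityʳ _)

shift₁ : (ℕ → ℕ) → ℕ → ℕ
shift₁ f zero    = 0
shift₁ f (suc n) = f n

-- Multiplication of a generating function by q^w.
shift : ℕ → (ℕ → ℕ) → ℕ → ℕ
shift zero    f = f
shift (suc w) f = shift₁ (shift w f)

shift-≥ : ∀ w f n → shift w f (w + n) ≡ f n
shift-≥ zero    f n = refl
shift-≥ (suc w) f n = shift-≥ w f n

shift-< : ∀ {w n} f → n < w → shift w f n ≡ 0
shift-< {suc w} {zero}  f _         = refl
shift-< {suc w} {suc n} f (s≤s n<w) = shift-< f n<w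

shift₁-cong : ∀ {f g} → f ≗ g → shift₁ f ≗ shift₁ g
shift₁-cong e zero    = refl
shift₁-cong e (suc n) = e n

shift-cong : ∀ w {f g} → f ≗ g → shift w f ≗ shift w g
shift-cong zero    e = e
shift-cong (suc w) e = shift₁-cong (shift-cong w e)

conv-shift₁ˡ : ∀ f g → conv (shift₁ f) g ≗ shift₁ (conv f g)
conv-shift₁ˡ f g zero    = refl
conv-shift₁ˡ f g (suc n) = refl

conv-shift₁ʳ : ∀ f g → conv f (shift₁ g) ≗ shift₁ (conv f g)
conv-shift₁ʳ f g zero          = *-zeroʳ (f 0)
conv-shift₁ʳ f g (suc zero)    = trans (cong (f 0 * g 0 +_) (*-zeroʳ (f 1))) (+-identityʳ _)
conv-shift₁ʳ f g (suc (suc n)) = cong (f 0 * g (suc n) +_) (conv-shift₁ʳ (f ∘ suc) g (suc n))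

conv-shiftˡ : ∀ w f g → conv (shift w f) g ≗ shift w (conv f g)
conv-shiftˡ zero    f g n = refl
conv-shiftˡ (suc w) f g n =
  trans (conv-shift₁ˡ (shift w f) g n) (shift₁-cong (conv-shiftˡ w f g) n)

conv-shiftʳ : ∀ w f g → conv f (shift w g) ≗ shift w (conv f g)
conv-shiftʳ zero    f g n = refl
conv-shiftʳ (suc w) f g n =
  trans (conv-shift₁ʳ f (shift w g) n) (shift₁-cong (conv-shiftʳ w f g) n)

-- The product rule for θ = q d/dq, applied to q^w f.
θ-shift : ∀ w f n → n * shift w f n ≡ w * shift w f n + shift w (λ i → i * f i) n
θ-shift zero    f n       = refl
θ-shift (suc w) f zero    = sym (trans (+-identityʳ _) (*-zeroʳ (suc w)))
θ-shift (suc w) f (suc n) = trans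
  (cong (shift w f n +_) (θ-shift w f n))
  (sym (+-assoc (shift w f n) _ _))

data View (w : ℕ) : ℕ → Set where
  below : ∀ {n} → n < w → View w n
  above : ∀ n → View w (w + n)

view : ∀ w n → View w n
view zero    n       = above n
view (suc w) zero    = below z<s
view (suc w) (suc n) with view w n
... | below n<w = below (s<s n<w)
... | above m   = above m

-- f ≡ g + shift w f determines f, since w is positive.
shift-unique : ∀ w {f f′} (g : ℕ → ℕ) → (∀ n → f n ≡ g n + shift (suc w) f n) →
               (∀ n → f′ n ≡ g n + shift (suc w) f′ n) → f ≗ f′
shift-unique w {f} {f′} g e e′ n = go (suc n) n ≤-refl
  where
  go : ∀ m n → n < m → f n ≡ f′ n
  go (suc m) n (s≤s n≤m) with view (suc w) n
  ... | below n<w = trans (e n) (trans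
          (cong (g n +_) (trans (shift-< f n<w) (sym (shift-< f′ n<w)))) (sym (e′ n)))
  ... | above k   = trans (e _) (trans
          (cong (g (suc w + k) +_) (trans (shift-≥ w f k)
            (trans (go m k (≤-trans (s≤s (m≤n+m k w)) n≤m)) (sym (shift-≥ w f′ k)))))
          (sym (e′ _)))

χ : ℕ → ℕ → ℕ
χ w k with w ∣? k
... | yes _ = 1
... | no  _ = 0

χ-yes : ∀ {w k} → w ∣ k → χ w k ≡ 1
χ-yes {w} {k} w∣k with w ∣? k
... | yes _   = refl
... | no  w∤k = contradiction w∣k w∤k

χ-no : ∀ {w k} → ¬ w ∣ k → χ w k ≡ 0
χ-no {w} {k} w∤k with w ∣? k
... | yes w∣k = contradiction w∣k w∤k
... | no  _   = refl

χ≤1 : ∀ w k → χ w k ≤ 1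
χ≤1 w k with w ∣? k
... | yes _ = s≤s z≤n
... | no  _ = z≤n

-- The generating function of `χ (suc w)` is the geometric series 1 / (1 - q^(w+1)), here cleared of
-- its denominator.
χ-recurrence : ∀ w n → χ (suc w) n ≡ δ n + shift (suc w) (χ (suc w)) n
χ-recurrence w n with view (suc w) n
χ-recurrence w zero    | below _   = χ-yes {suc w} (suc w ∣0)
χ-recurrence w (suc n) | below n<w = trans (χ-no (>⇒∤ n<w)) (sym (shift-< _ n<w))
... | above k with suc w ∣? k
...   | yes w∣k = trans (χ-yes (∣m∣n⇒∣m+n ∣-refl w∣k))
                        (sym (trans (shift-≥ w (χ (suc w)) k) (χ-yes w∣k)))
...   | no  w∤k = trans (χ-no (λ d → w∤k (∣m+n∣m⇒∣n d ∣-refl)))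
                        (sym (trans (shift-≥ w (χ (suc w)) k) (χ-no w∤k)))

-- The coefficients of ∏ 1 / (1 - q^(1+w)), over the w in the list.
coeff : List ℕ → ℕ → ℕ
coeff []       = δ
coeff (w ∷ ws) = conv (χ (suc w)) (coeff ws)

-- For positive k, the coefficients of q d/dq of the logarithm of the product: a factor 1 / (1 -
-- q^(w+1)) contributes w + 1 at each multiple of w + 1.
powerSum : List ℕ → ℕ → ℕ
powerSum []       k = 0
powerSum (w ∷ ws) k = powerSum ws k + suc w * χ (suc w) k

-- The term at k = 0 of a sum of divisors is junk.
drop₀ : (ℕ → ℕ) → ℕ → ℕ
drop₀ f zero    = 0
drop₀ f (suc k) = f (suc k)

coeff-∷ : ∀ w ws n → coeff (w ∷ ws) n ≡ coeff ws n + shift (suc w) (coeff (w ∷ ws)) n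
coeff-∷ w ws n = begin
  conv (χ (suc w)) (coeff ws) n
    ≡⟨ conv-congˡ (coeff ws) (χ-recurrence w) n ⟩
  conv (λ i → δ i + shift (suc w) (χ (suc w)) i) (coeff ws) n
    ≡⟨ conv-+ˡ δ (shift (suc w) (χ (suc w))) (coeff ws) n ⟩
  conv δ (coeff ws) n + conv (shift (suc w) (χ (suc w))) (coeff ws) n
    ≡⟨ cong₂ _+_ (conv-identityˡ (coeff ws) n) (conv-shiftˡ (suc w) (χ (suc w)) (coeff ws) n) ⟩
  coeff ws n + shift (suc w) (coeff (w ∷ ws)) n ∎
  where open ≡-Reasoning

drop₀-χ : ∀ w n → drop₀ (χ (suc w)) n ≡ shift (suc w) (χ (suc w)) n
drop₀-χ w zero    = refl
drop₀-χ w (suc n) = χ-recurrence w (suc n)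

drop₀-powerSum : ∀ w ws k → drop₀ (powerSum (w ∷ ws)) k ≡
                 drop₀ (powerSum ws) k + suc w * drop₀ (χ (suc w)) k
drop₀-powerSum w ws zero    = sym (*-zeroʳ w)
drop₀-powerSum w ws (suc k) = refl

-- Let Q = P / (1 - q^(w+1)), let θ = q d/dq, and let S be the series of `powerSum` without its
-- constant term. Both θQ and S Q solve f = θP + (w+1) q^(w+1) Q + q^(w+1) f, where the induction
-- hypothesis for P enters the second case, so `shift-unique` identifies them.
logarithmic-derivative : ∀ ws n → n * coeff ws n ≡ conv (drop₀ (powerSum ws)) (coeff ws) n
logarithmic-derivative [] n = trans (lhs n) (sym (rhs n))
  where
  lhs : ∀ n → n * δ n ≡ 0
  lhs zero    = refl
  lhs (suc n) = *-zeroʳ n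
  zero-fun : drop₀ (powerSum []) ≗ (λ _ → 0)
  zero-fun zero    = refl
  zero-fun (suc _) = refl
  rhs : ∀ n → conv (drop₀ (powerSum [])) δ n ≡ 0
  rhs n = trans (conv-congˡ δ zero-fun n) (conv-zeroˡ δ n)
logarithmic-derivative (w ∷ ws) = shift-unique w G eqˡ eqʳ
  where
  open ≡-Reasoning
  Q = coeff (w ∷ ws)
  s = drop₀ (powerSum ws)
  c = χ (suc w)
  G : ℕ → ℕ
  G n = n * coeff ws n + suc w * shift (suc w) Q n
  eqˡ : ∀ n → n * Q n ≡ G n + shift (suc w) (λ i → i * Q i) n
  eqˡ n = begin
    n * Q n                               ≡⟨ cong (n *_) (coeff-∷ w ws n) ⟩
    n * (coeff ws n + shift (suc w) Q n)      ≡⟨ *-distribˡ-+ n (coeff ws n) _ ⟩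
    n * coeff ws n + n * shift (suc w) Q n    ≡⟨ cong (n * coeff ws n +_) (θ-shift (suc w) Q n) ⟩
    n * coeff ws n + (suc w * shift (suc w) Q n + shift (suc w) (λ i → i * Q i) n)
                                          ≡⟨ +-assoc (n * coeff ws n) _ _ ⟨
    G n + shift (suc w) (λ i → i * Q i) n ∎
  R : ℕ → ℕ
  R = conv (drop₀ (powerSum (w ∷ ws))) Q
  expand : ∀ n → R n ≡ conv s Q n + suc w * conv (drop₀ c) Q n
  expand n = begin
    R n ≡⟨ conv-congˡ Q (drop₀-powerSum w ws) n ⟩
    conv (λ k → s k + suc w * drop₀ c k) Q n
        ≡⟨ conv-+ˡ s (λ k → suc w * drop₀ c k) Q n ⟩
    conv s Q n + conv (λ k → suc w * drop₀ c k) Q n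
        ≡⟨ cong (conv s Q n +_) (conv-*ˡ (suc w) (drop₀ c) Q n) ⟩
    conv s Q n + suc w * conv (drop₀ c) Q n ∎
  conv-s : ∀ n → conv s Q n ≡ n * coeff ws n + shift (suc w) (conv s Q) n
  conv-s n = begin
    conv s Q n ≡⟨ conv-congʳ s (coeff-∷ w ws) n ⟩
    conv s (λ i → coeff ws i + shift (suc w) Q i) n ≡⟨ conv-+ʳ s (coeff ws) (shift (suc w) Q) n ⟩
    conv s (coeff ws) n + conv s (shift (suc w) Q) n
      ≡⟨ cong₂ _+_ (sym (logarithmic-derivative ws n)) (conv-shiftʳ (suc w) s Q n) ⟩
    n * coeff ws n + shift (suc w) (conv s Q) n ∎
  drop₀-recurrence : ∀ n → drop₀ c n ≡ shift (suc w) (λ i → δ i + drop₀ c i) n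
  drop₀-recurrence n = trans (drop₀-χ w n) (shift-cong (suc w) c≡ n)
    where
    c≡ : ∀ i → c i ≡ δ i + drop₀ c i
    c≡ i = trans (χ-recurrence w i) (cong (δ i +_) (sym (drop₀-χ w i)))
  conv-c : ∀ n → conv (drop₀ c) Q n ≡ shift (suc w) (λ i → Q i + conv (drop₀ c) Q i) n
  conv-c n = begin
    conv (drop₀ c) Q n ≡⟨ conv-congˡ Q drop₀-recurrence n ⟩
    conv (shift (suc w) (λ i → δ i + drop₀ c i)) Q n
      ≡⟨ conv-shiftˡ (suc w) (λ i → δ i + drop₀ c i) Q n ⟩
    shift (suc w) (conv (λ i → δ i + drop₀ c i) Q) n
      ≡⟨ shift-cong (suc w) (λ i → trans (conv-+ˡ δ (drop₀ c) Q i)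
           (cong (_+ conv (drop₀ c) Q i) (conv-identityˡ Q i))) n ⟩
    shift (suc w) (λ i → Q i + conv (drop₀ c) Q i) n ∎
  shift-+ : ∀ w f g n → shift w (λ i → f i + g i) n ≡ shift w f n + shift w g n
  shift-+ zero    f g n       = refl
  shift-+ (suc w) f g zero    = refl
  shift-+ (suc w) f g (suc n) = shift-+ w f g n
  shift-* : ∀ w a f n → shift w (λ i → a * f i) n ≡ a * shift w f n
  shift-* zero    a f n       = refl
  shift-* (suc w) a f zero    = sym (*-zeroʳ a)
  shift-* (suc w) a f (suc n) = shift-* w a f n
  rearrange : ∀ a b d x y → a + b + d * (x + y) ≡ a + d * x + (b + d * y)
  rearrange = solve-∀
  eqʳ : ∀ n → R n ≡ G n + shift (suc w) R n
  eqʳ n = begin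
    R n ≡⟨ expand n ⟩
    conv s Q n + suc w * conv (drop₀ c) Q n
      ≡⟨ cong₂ (λ u v → u + suc w * v) (conv-s n)
           (trans (conv-c n) (shift-+ (suc w) Q (conv (drop₀ c) Q) n)) ⟩
    n * coeff ws n + shift (suc w) (conv s Q) n
      + suc w * (shift (suc w) Q n + shift (suc w) (conv (drop₀ c) Q) n)
      ≡⟨ rearrange (n * coeff ws n) _ (suc w) (shift (suc w) Q n) _ ⟩
    G n + (shift (suc w) (conv s Q) n + suc w * shift (suc w) (conv (drop₀ c) Q) n)
      ≡⟨ cong (λ u → G n + (shift (suc w) (conv s Q) n + u))
           (shift-* (suc w) (suc w) (conv (drop₀ c) Q) n) ⟨
    G n + (shift (suc w) (conv s Q) n + shift (suc w) (λ i → suc w * conv (drop₀ c) Q i) n)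
      ≡⟨ cong (G n +_) (shift-+ (suc w) (conv s Q) (λ i → suc w * conv (drop₀ c) Q i) n) ⟨
    G n + shift (suc w) (λ i → conv s Q i + suc w * conv (drop₀ c) Q i) n
      ≡⟨ cong (G n +_) (shift-cong (suc w) (sym ∘ expand) n) ⟩
    G n + shift (suc w) R n ∎

-- Paths of interlacing partitions

-- A weighted set is represented by its weight function.
record _≃_ {A B : Set} (f : A → ℕ) (g : B → ℕ) : Set where
  field
    to      : A → B
    from    : B → A
    to-from : ∀ b → to (from b) ≡ b
    from-to : ∀ a → from (to a) ≡ a
    weight  : ∀ a → g (to a) ≡ f a

open _≃_

infixr 5 _⊕_
_⊕_ : {A B : Set} → (A → ℕ) → (B → ℕ) → A × B → ℕ
(f ⊕ g) (a , b) = f a + g b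

≃-trans : {A B C : Set} {f : A → ℕ} {g : B → ℕ} {h : C → ℕ} → f ≃ g → g ≃ h → f ≃ h
≃-trans p q = record
  { to      = to q ∘ to p
  ; from    = from p ∘ from q
  ; to-from = λ c → trans (cong (to q) (to-from p (from q c))) (to-from q c)
  ; from-to = λ a → trans (cong (from p) (from-to q (to p a))) (from-to p a)
  ; weight  = λ a → trans (weight q (to p a)) (weight p a)
  }

⊕-congˡ : {A B C : Set} {f : A → ℕ} {g : B → ℕ} (h : C → ℕ) → f ≃ g → (h ⊕ f) ≃ (h ⊕ g)
⊕-congˡ h p = record
  { to      = λ (c , a) → c , to p a
  ; from    = λ (c , b) → c , from p b
  ; to-from = λ (c , b) → cong (c ,_) (to-from p b)
  ; from-to = λ (c , a) → cong (c ,_) (from-to p a)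
  ; weight  = λ (c , a) → cong (h c +_) (weight p a)
  }

⊕-congʳ : {A B C : Set} {f : A → ℕ} {g : B → ℕ} (h : C → ℕ) → f ≃ g → (f ⊕ h) ≃ (g ⊕ h)
⊕-congʳ h p = record
  { to      = λ (a , c) → to p a , c
  ; from    = λ (b , c) → from p b , c
  ; to-from = λ (b , c) → cong (_, c) (to-from p b)
  ; from-to = λ (a , c) → cong (_, c) (from-to p a)
  ; weight  = λ (a , c) → cong (_+ h c) (weight p a)
  }

⊕-assoc : {A B C : Set} (f : A → ℕ) (g : B → ℕ) (h : C → ℕ) →
          (f ⊕ (g ⊕ h)) ≃ ((f ⊕ g) ⊕ h)
⊕-assoc f g h = record
  { to      = λ (a , b , c) → (a , b) , c
  ; from    = λ ((a , b) , c) → a , b , c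
  ; to-from = λ _ → refl
  ; from-to = λ _ → refl
  ; weight  = λ (a , b , c) → +-assoc (f a) _ _
  }

-- λ ▷ μ : λ₀ ≥ μ₀ ≥ λ₁ ≥ … ≥ λ_d.   ν ▶ λ : ν₀ ≥ λ₀ ≥ ν₁ ≥ … ≥ λ_{d-1}.
infix 4 _▷_ _▶_
_▷_ : ∀ {d} → Vec ℕ (suc d) → Vec ℕ d → Set
_       ▷ []       = ⊤
(a ∷ u) ▷ (b ∷ v) = b ≤ a × head u ≤ b × u ▷ v

_▶_ : ∀ {d} → Vec ℕ d → Vec ℕ d → Set
[]          ▶ []      = ⊤
(a ∷ [])    ▶ (b ∷ [])    = b ≤ a
(a ∷ c ∷ u) ▶ (b ∷ v) = b ≤ a × c ≤ b × (c ∷ u) ▶ v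

▷-irrelevant : ∀ {d} (u : Vec ℕ (suc d)) (v : Vec ℕ d) (p q : u ▷ v) → p ≡ q
▷-irrelevant _       []      _           _             = refl
▷-irrelevant (_ ∷ u) (_ ∷ v) (p , q , r) (p′ , q′ , r′) = cong₂ _,_ (≤-irrelevant p p′)
  (cong₂ _,_ (≤-irrelevant q q′) (▷-irrelevant u v r r′))

▶-irrelevant : ∀ {d} (u v : Vec ℕ d) (p q : u ▶ v) → p ≡ q
▶-irrelevant []          []      _           _             = refl
▶-irrelevant (_ ∷ [])    (_ ∷ []) p          q             = ≤-irrelevant p q
▶-irrelevant (_ ∷ c ∷ u) (_ ∷ v) (p , q , r) (p′ , q′ , r′) = cong₂ _,_ (≤-irrelevant p p′)
  (cong₂ _,_ (≤-irrelevant q q′) (▶-irrelevant (c ∷ u) v r r′))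

▷⇒sum≤ : ∀ {d} (u : Vec ℕ (suc d)) (v : Vec ℕ d) → u ▷ v → sum v ≤ sum u
▷⇒sum≤ _       []      _           = z≤n
▷⇒sum≤ (_ ∷ u) (_ ∷ v) (p , _ , r) = +-mono-≤ p (▷⇒sum≤ u v r)

▶⇒sum≤ : ∀ {d} (u v : Vec ℕ d) → u ▶ v → sum v ≤ sum u
▶⇒sum≤ []          []      _           = z≤n
▶⇒sum≤ (_ ∷ [])    (_ ∷ []) p          = +-monoˡ-≤ 0 p
▶⇒sum≤ (_ ∷ c ∷ u) (_ ∷ v) (p , _ , r) = +-mono-≤ p (▶⇒sum≤ (c ∷ u) v r)

-- Word d: steps between partitions from d parts down to none.
data Word : ℕ → Set where
  end  : Word 0
  up   : ∀ {d} → ℕ → Word d → Word d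
  down : ∀ {d} → ℕ → Word d → Word (suc d)

Path : ∀ {d} → Word d → Vec ℕ d → Set
Path end             _ = ⊤
Path (up x w)        u = Σ (Vec ℕ _) λ v → v ▶ u × Path w v
Path (down {d} y w)  u = Σ (Vec ℕ d) λ v → u ▷ v × Path w v

-- down y has weight y + 1, so that up x and down y together have positive weight.
cost : ∀ {d} (w : Word d) (u : Vec ℕ d) → Path w u → ℕ
cost end        u _           = 0
cost (up x w)   u (v , _ , p) = x * (sum v ∸ sum u) + cost w v p
cost (down y w) u (v , _ , p) = suc y * (sum u ∸ sum v) + cost w v p

-- A missing part counts as 0; this occurs at the lower end of the last interval of `Between`.
first : ∀ {d} → Vec ℕ d → ℕ
first []      = 0
first (a ∷ _) = a

reflect : ∀ {d} → Vec ℕ (suc d) → Vec ℕ d → Vec ℕ d → Vec ℕ d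
reflect _       []      []      = []
reflect (a ∷ u) (b ∷ v) (k ∷ κ) = (a ⊓ b) + (head u ⊔ first v) ∸ k ∷ reflect u v κ

-- For ν = n ∷ κ, the conditions ν ▶ u and ν ▷ v constrain the entries of κ exactly
-- as u ▷ κ and v ▶ κ do: κᵢ lies between max(uᵢ₊₁, vᵢ₊₁) and min(uᵢ, vᵢ). The
-- local rule reflects these intervals.
Between : ∀ {d} → Vec ℕ (suc d) → Vec ℕ d → Vec ℕ d → Set
Between _       []      []      = ⊤
Between (a ∷ u) (b ∷ v) (k ∷ κ) = k ≤ a ⊓ b × head u ⊔ first v ≤ k × Between u v κ

reflect-between : ∀ {d} (u : Vec ℕ (suc d)) v κ → Between u v κ → Between u v (reflect u v κ)
reflect-between _       []      []      _           = tt
reflect-between (a ∷ u) (b ∷ v) (k ∷ κ) (p , q , r) =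
    m≤n+o⇒m∸n≤o ((a ⊓ b) + (head u ⊔ first v)) k (≤-trans (+-monoʳ-≤ (a ⊓ b) q) (≤-reflexive (+-comm (a ⊓ b) k)))
  , ≤-trans (m≤n+m _ (a ⊓ b ∸ k)) (≤-reflexive (sym (+-∸-comm _ p)))
  , reflect-between u v κ r

reflect-involutive : ∀ {d} (u : Vec ℕ (suc d)) v κ → Between u v κ →
                     reflect u v (reflect u v κ) ≡ κ
reflect-involutive _       []      []      _           = refl
reflect-involutive (a ∷ u) (b ∷ v) (k ∷ κ) (p , _ , r) =
  cong₂ _∷_ (m∸[m∸n]≡n (≤-trans p (m≤m+n _ _))) (reflect-involutive u v κ r)

⊔+⊓ : ∀ a b → a ⊔ b + a ⊓ b ≡ a + b
⊔+⊓ a b with ≤-total a b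
... | inj₁ a≤b = trans (cong₂ _+_ (m≤n⇒m⊔n≡n a≤b) (m≤n⇒m⊓n≡m a≤b)) (+-comm b a)

... | inj₂ b≤a = cong₂ _+_ (m≥n⇒m⊔n≡m b≤a) (m≥n⇒m⊓n≡n b≤a)


-- An entry and its reflection add up to a minimum plus the maximum of the next two parts. With the
-- maximum of the first parts in front, each minimum meets the maximum of the same two parts, and
-- together they give the sum of the two.
sum-reflect : ∀ {d} (u : Vec ℕ (suc d)) v κ → Between u v κ →
              head u ⊔ first v + sum (reflect u v κ) + sum κ ≡ sum u + sum v
sum-reflect (a ∷ [])    []      []      _ =
  trans (+-identityʳ _) (trans (+-identityʳ _) (trans (⊔-identityʳ a)
    (sym (trans (+-identityʳ _) (+-identityʳ a)))))
sum-reflect (a ∷ u) (b ∷ v) (k ∷ κ) (p , _ , r) = begin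
  a ⊔ b + (l ∸ k + S) + (k + K)       ≡⟨ e₁ (a ⊔ b) (l ∸ k) S k K ⟩
  a ⊔ b + (l ∸ k + k) + (S + K)       ≡⟨ cong (λ z → a ⊔ b + z + (S + K))
                                           (m∸n+n≡m (≤-trans p (m≤m+n _ _))) ⟩
  a ⊔ b + (a ⊓ b + m) + (S + K)       ≡⟨ e₂ (a ⊔ b) (a ⊓ b) m S K ⟩
  a ⊔ b + a ⊓ b + (m + S + K)         ≡⟨ cong₂ _+_ (⊔+⊓ a b) (sum-reflect u v κ r) ⟩
  a + b + (sum u + sum v)             ≡⟨ e₃ a b (sum u) (sum v) ⟩
  a + sum u + (b + sum v)             ∎
  where
  open ≡-Reasoning
  m = head u ⊔ first v
  l = (a ⊓ b) + m
  S = sum (reflect u v κ)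
  K = sum κ
  e₁ : ∀ x y z s t → x + (y + z) + (s + t) ≡ x + (y + s) + (z + t)
  e₁ = solve-∀
  e₂ : ∀ x y z s t → x + (y + z) + (s + t) ≡ x + y + (z + s + t)
  e₂ = solve-∀
  e₃ : ∀ x y z s → x + y + (z + s) ≡ x + z + (y + s)
  e₃ = solve-∀

above⇒between : ∀ {d} (u : Vec ℕ (suc d)) v n κ → (n ∷ κ) ▶ u → (n ∷ κ) ▷ v →
                head u ⊔ first v ≤ n × Between u v κ
above⇒between (a ∷ [])     []      n []      i           _           =
  ≤-trans (≤-reflexive (⊔-identityʳ a)) i , tt
above⇒between (a ∷ u)      (b ∷ v) n (k ∷ κ) (p , q , r) (p′ , q′ , r′) =
  let (s , t) = above⇒between u v k κ r r′ in ⊔-lub p p′ , ⊓-glb q q′ , s , t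

between⇒above : ∀ {d} (u : Vec ℕ (suc d)) v n κ → head u ⊔ first v ≤ n → Between u v κ →
                (n ∷ κ) ▶ u × (n ∷ κ) ▷ v
between⇒above (a ∷ [])    []      n []      h _           = m⊔n≤o⇒m≤o a 0 h , tt
between⇒above (a ∷ u)     (b ∷ v) n (k ∷ κ) h (p , q , r) =
  let (s , t) = between⇒above u v k κ q r in
  (m⊔n≤o⇒m≤o a b h , m≤n⊓o⇒m≤n a b p , s) , (m⊔n≤o⇒n≤o a b h , m≤n⊓o⇒m≤o a b p , t)

below⇒between : ∀ {d} (u : Vec ℕ (suc d)) v κ → u ▷ κ → v ▶ κ → Between u v κ
below⇒between _       []           []      _           _           = tt
below⇒between (a ∷ u) (b ∷ [])     (k ∷ []) (p , q , r) i          =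
  ⊓-glb p i , ⊔-lub q z≤n , tt
below⇒between (a ∷ u) (b ∷ b′ ∷ v) (k ∷ κ) (p , q , r) (p′ , q′ , r′) =
  ⊓-glb p p′ , ⊔-lub q q′ , below⇒between u (b′ ∷ v) κ r r′

between⇒below : ∀ {d} (u : Vec ℕ (suc d)) v κ → Between u v κ → u ▷ κ × v ▶ κ
between⇒below _       []           []       _           = tt , tt
between⇒below (a ∷ u) (b ∷ [])     (k ∷ []) (p , q , _) =
  (m≤n⊓o⇒m≤n a b p , m⊔n≤o⇒m≤o (head u) 0 q , tt) , m≤n⊓o⇒m≤o a b p
between⇒below (a ∷ u) (b ∷ b′ ∷ v) (k ∷ κ)  (p , q , r) =
  let (s , t) = between⇒below u (b′ ∷ v) κ r in
  (m≤n⊓o⇒m≤n a b p , m⊔n≤o⇒m≤o (head u) b′ q , s) ,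
  (m≤n⊓o⇒m≤o a b p , m⊔n≤o⇒n≤o (head u) b′ q , t)

multiples : ℕ → ℕ → ℕ
multiples w m = m * suc w

module _ {d} (x y : ℕ) (w : Word d) (u : Vec ℕ (suc d)) where

  private
    UpDown   = Path (up x (down y w)) u
    DownUp   = Path (down y (up x w)) u

    upDown≡ : ∀ {ν ν′ i i′ μ j j′} {p : Path w μ} → ν ≡ ν′ →
              _≡_ {A = UpDown} (ν , i , μ , j , p) (ν′ , i′ , μ , j′ , p)
    upDown≡ {ν} {i = i} {i′} {μ} {j} {j′} {p} refl =
      cong₂ (λ i j → ν , i , μ , j , p) (▶-irrelevant ν u i i′) (▷-irrelevant ν μ j j′)

    downUp≡ : ∀ {m m′ κ κ′ i i′ μ j j′} {p : Path w μ} → m ≡ m′ → κ ≡ κ′ →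
              _≡_ {A = ℕ × DownUp} (m , κ , i , μ , j , p) (m′ , κ′ , i′ , μ , j′ , p)
    downUp≡ {m} {κ = κ} {i = i} {i′} {μ} {j} {j′} {p} refl refl =
      cong₂ (λ i j → m , κ , i , μ , j , p) (▷-irrelevant u κ i i′) (▶-irrelevant μ κ j j′)

    -- Here `a` and `b` are the sizes of λ and μ. By the size equation, |ν| - |λ| exceeds |μ| - |κ|
    -- by m, and |ν| - |μ| exceeds |λ| - |κ| by m. The surplus costs m x + m (y + 1), which is the
    -- weight of the free number m.
    weigh : ∀ {ν κ a b} m c → κ ≤ a → κ ≤ b → ν + κ ≡ m + (a + b) →
            m * suc (x + y) + (suc y * (a ∸ κ) + (x * (b ∸ κ) + c))
            ≡ x * (ν ∸ a) + (suc y * (ν ∸ b) + c)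
    weigh {ν} {κ} {a} {b} m c κ≤a κ≤b e = begin
      m * suc (x + y) + (suc y * s + (x * t + c)) ≡⟨ rearrange m x y s t c ⟩
      x * (t + m) + (suc y * (s + m) + c)
        ≡⟨ cong₂ (λ i j → x * i + (suc y * j + c)) (difference a ν≡ˡ) (difference b ν≡ʳ) ⟨
      x * (ν ∸ a) + (suc y * (ν ∸ b) + c) ∎
      where
      open ≡-Reasoning
      s = a ∸ κ
      t = b ∸ κ
      difference : ∀ {i k} j → i ≡ j + k → i ∸ j ≡ k
      difference {k = k} j refl = m+n∸m≡n j k
      split : ∀ m k s t → m + ((k + s) + (k + t)) ≡ (k + s) + (t + m) + k
      split = solve-∀
      split′ : ∀ m k s t → m + ((k + s) + (k + t)) ≡ (k + t) + (s + m) + k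
      split′ = solve-∀
      a≡ : κ + s ≡ a
      a≡ = m+[n∸m]≡n κ≤a
      b≡ : κ + t ≡ b
      b≡ = m+[n∸m]≡n κ≤b
      e′ : ν + κ ≡ m + ((κ + s) + (κ + t))
      e′ = trans e (cong₂ (λ i j → m + (i + j)) (sym a≡) (sym b≡))
      ν≡ˡ : ν ≡ a + (t + m)
      ν≡ˡ = trans (+-cancelʳ-≡ κ _ _ (trans e′ (split m κ s t))) (cong (_+ (t + m)) a≡)
      ν≡ʳ : ν ≡ b + (s + m)
      ν≡ʳ = trans (+-cancelʳ-≡ κ _ _ (trans e′ (split′ m κ s t))) (cong (_+ (s + m)) b≡)
      rearrange : ∀ m x y s t c → m * suc (x + y) + (suc y * s + (x * t + c)) ≡
                  x * (t + m) + (suc y * (s + m) + c)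
      rearrange = solve-∀

  -- The local rule: λ ≺ ν ≻ μ corresponds to m ∈ ℕ and λ ≻ κ ≺ μ, where
  -- ν₀ = max(λ₀, μ₀) + m and νᵢ₊₁ = min(λᵢ, μᵢ) + max(λᵢ₊₁, μᵢ₊₁) - κᵢ.
  exchange : cost (up x (down y w)) u ≃ (multiples (x + y) ⊕ cost (down y (up x w)) u)
  exchange = record
    { to      = to′
    ; from    = from′
    ; to-from = λ (m , κ , i , μ , j , p) → downUp≡
        (m+n∸n≡m m (head u ⊔ first μ)) (reflect-involutive u μ κ (below⇒between u μ κ i j))
    ; from-to = λ where
        (n ∷ v , i , μ , j , p) → upDown≡ (cong₂ _∷_
          (m∸n+n≡m (proj₁ (above⇒between u μ n v i j)))
          (reflect-involutive u μ v (proj₂ (above⇒between u μ n v i j))))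
    ; weight  = λ where
        (n ∷ v , i , μ , j , p) →
          let (h , k) = above⇒between u μ n v i j
              (i′ , j′) = between⇒below u μ (reflect u μ v) (reflect-between u μ v k)
          in weigh (n ∸ (head u ⊔ first μ)) (cost w μ p) (▷⇒sum≤ u _ i′) (▶⇒sum≤ μ _ j′) (total n v μ h k)
    }
    where
    to′ : UpDown → ℕ × DownUp
    to′ (n ∷ v , i , μ , j , p) =
      let (_ , k)   = above⇒between u μ n v i j
          (i′ , j′) = between⇒below u μ (reflect u μ v) (reflect-between u μ v k)
      in n ∸ (head u ⊔ first μ) , reflect u μ v , i′ , μ , j′ , p

    from′ : ℕ × DownUp → UpDown
    from′ (m , κ , i , μ , j , p) =
      let (i′ , j′) = between⇒above u μ (m + (head u ⊔ first μ)) (reflect u μ κ)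
                        (m≤n+m _ m) (reflect-between u μ κ (below⇒between u μ κ i j))
      in m + (head u ⊔ first μ) ∷ reflect u μ κ , i′ , μ , j′ , p

    total : ∀ n v μ → head u ⊔ first μ ≤ n → Between u μ v →
            n + sum v + sum (reflect u μ v) ≡ n ∸ (head u ⊔ first μ) + (sum u + sum μ)
    total n v μ h k = begin
      n + sum v + r           ≡⟨ cong (λ z → z + sum v + r) (m∸n+n≡m h) ⟨
      n ∸ H + H + sum v + r   ≡⟨ rearrange (n ∸ H) H (sum v) r ⟩
      n ∸ H + (H + r + sum v) ≡⟨ cong (n ∸ H +_) (sum-reflect u μ v k) ⟩
      n ∸ H + (sum u + sum μ) ∎
      where
      open ≡-Reasoning
      H = head u ⊔ first μ
      r = sum (reflect u μ v)
      rearrange : ∀ a b c d → a + b + c + d ≡ a + (b + d + c)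
      rearrange = solve-∀

-- Brings a factor that was split off behind a step in front of that step. The cost `c` and the
-- interlacing condition `I` of the step depend only on the next partition, which stays the same.
step-cong : ∀ {V A : Set} {I Q R : V → Set} (f : A → ℕ) (c : V → ℕ)
            {g : ∀ v → Q v → ℕ} {h : ∀ v → R v → ℕ} → (∀ v → g v ≃ (f ⊕ h v)) →
            (λ (x : Σ V (λ v → I v × Q v)) → c (proj₁ x) + g (proj₁ x) (proj₂ (proj₂ x)))
            ≃ (f ⊕ (λ (x : Σ V (λ v → I v × R v)) → c (proj₁ x) + h (proj₁ x) (proj₂ (proj₂ x))))
step-cong f c {h = h} e = record
  { to      = λ (v , i , p) → let (a , r) = to (e v) p in a , v , i , r
  ; from    = λ (a , v , i , r) → v , i , from (e v) (a , r)
  ; to-from = λ (a , v , i , r) → cong (λ (a , r) → a , v , i , r) (to-from (e v) (a , r))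
  ; from-to = λ (v , i , p) → cong (λ p → v , i , p) (from-to (e v) p)
  ; weight  = λ (v , i , p) → let (a , r) = to (e v) p in trans
      (exchange-+ (f a) (c v) (h v r)) (cong (c v +_) (weight (e v) p))
  }
  where
  exchange-+ : ∀ x y z → x + (y + z) ≡ y + (x + z)
  exchange-+ = solve-∀

-- Sorting the steps of a path

ups : ∀ {d} → ℕ → Word d → Word d
ups zero    w = w
ups (suc x) w = up x (ups x w)

downs : ℕ → (k : ℕ) → Word k
downs y zero    = end
downs y (suc k) = down y (downs (suc y) k)

downsUps : ℕ → ℕ → (k : ℕ) → Word k
downsUps x y zero    = ups x end
downsUps x y (suc k) = down y (downsUps x (suc y) k)

Mult : List ℕ → Set
Mult []       = ⊤
Mult (_ ∷ ws) = ℕ × Mult ws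

size : ∀ ws → Mult ws → ℕ
size []       _       = 0
size (w ∷ ws) (m , r) = multiples w m + size ws r

row : ℕ → ℕ → List ℕ
row zero    y = []
row (suc x) y = x + y ∷ row x y

cells : ℕ → ℕ → ℕ → List ℕ
cells x y zero    = []
cells x y (suc k) = row x y ++ cells x (suc y) k

size-++ : ∀ vs ws → (size vs ⊕ size ws) ≃ size (vs ++ ws)
size-++ []       ws = record
  { to = proj₂ ; from = tt ,_ ; to-from = λ _ → refl ; from-to = λ _ → refl
  ; weight = λ _ → refl }
size-++ (v ∷ vs) ws = ≃-trans assoc′ (⊕-congˡ (multiples v) (size-++ vs ws))
  where
  assoc′ : (size (v ∷ vs) ⊕ size ws) ≃ (multiples v ⊕ (size vs ⊕ size ws))
  assoc′ = record
    { to      = λ ((a , b) , c) → a , b , c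
    ; from    = λ (a , b , c) → (a , b) , c
    ; to-from = λ _ → refl
    ; from-to = λ _ → refl
    ; weight  = λ ((a , b) , c) → sym (+-assoc (multiples v a) _ _)
    }

-- The down step moves to the front, passing the innermost up step first. Its exchange with `up i`
-- releases a number of weight i + y + 1, and these weights make up `row x y`.
ups-down : ∀ {d} x y (w : Word d) u →
           cost (ups x (down y w)) u ≃ (size (row x y) ⊕ cost (down y (ups x w)) u)
ups-down zero    y w u = record
  { to = tt ,_ ; from = proj₂ ; to-from = λ _ → refl ; from-to = λ _ → refl
  ; weight = λ _ → refl }
ups-down (suc x) y w u = ≃-trans
  (step-cong (size (row x y)) (λ v → x * (sum v ∸ sum u)) (ups-down x y w))
  (≃-trans (⊕-congˡ (size (row x y)) (exchange x y (ups x w) u))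
  (≃-trans (⊕-assoc (size (row x y)) (multiples (x + y)) _)
           (⊕-congʳ (cost (down y (ups (suc x) w)) u) comm′)))
  where
  comm′ : (size (row x y) ⊕ multiples (x + y)) ≃ size (row (suc x) y)
  comm′ = record
    { to      = λ (a , b) → b , a
    ; from    = λ (a , b) → b , a
    ; to-from = λ _ → refl
    ; from-to = λ _ → refl
    ; weight  = λ (a , b) → +-comm (multiples (x + y) b) (size (row x y) a)
    }

ups-downs : ∀ x y k u →
            cost (ups x (downs y k)) u ≃ (size (cells x y k) ⊕ cost (downsUps x y k) u)
ups-downs x y zero    u = record
  { to = tt ,_ ; from = proj₂ ; to-from = λ _ → refl ; from-to = λ _ → refl
  ; weight = λ _ → refl }
ups-downs x y (suc k) u = ≃-trans (ups-down x y (downs (suc y) k) u)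
  (≃-trans (⊕-congˡ (size (row x y)) (step-cong (size (cells x (suc y) k))
     (λ v → suc y * (sum u ∸ sum v)) (ups-downs x (suc y) k)))
  (≃-trans (⊕-assoc (size (row x y)) (size (cells x (suc y) k)) _)
    (⊕-congʳ (cost (down y (downsUps x (suc y) k)) u) (size-++ (row x y) (cells x (suc y) k)))))

module _ (x : ℕ) where

  private
    emptyUps : ∀ x → Path (ups x end) []
    emptyUps zero    = tt
    emptyUps (suc x) = [] , tt , emptyUps x

    emptyUps-unique : ∀ x (p : Path (ups x end) []) → emptyUps x ≡ p
    emptyUps-unique zero    tt            = refl
    emptyUps-unique (suc x) ([] , tt , p) = cong (λ p → [] , tt , p) (emptyUps-unique x p)

    cost-emptyUps : ∀ x (p : Path (ups x end) []) → cost (ups x end) [] p ≡ 0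
    cost-emptyUps zero    _             = refl
    cost-emptyUps (suc x) ([] , tt , p) = cong₂ _+_ (*-zeroʳ x) (cost-emptyUps x p)

    zeros : ∀ k → replicate (suc k) 0 ▷ replicate k 0
    zeros zero    = tt
    zeros (suc k) = z≤n , z≤n , zeros k

    zeros-unique : ∀ k (v : Vec ℕ k) → replicate (suc k) 0 ▷ v → replicate k 0 ≡ v
    zeros-unique zero    []      _             = refl
    zeros-unique (suc k) (a ∷ v) (a≤0 , _ , i) =
      cong₂ _∷_ (sym (n≤0⇒n≡0 a≤0)) (zeros-unique k v i)

  empty : ∀ y k → Path (downsUps x y k) (replicate k 0)
  empty y zero    = emptyUps x
  empty y (suc k) = replicate k 0 , zeros k , empty (suc y) k

  -- In the sorted word the down steps come first, and below the zero partition lies only a zero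
  -- partition. When the up steps begin, no parts are left that could grow.
  empty-unique : ∀ y k (p : Path (downsUps x y k) (replicate k 0)) → empty y k ≡ p
  empty-unique y zero    p           = emptyUps-unique x p
  empty-unique y (suc k) (v , i , p) with zeros-unique k v i
  ... | refl = cong₂ (λ i p → replicate k 0 , i , p)
                 (▷-irrelevant (replicate (suc k) 0) (replicate k 0) (zeros k) i)
                 (empty-unique (suc y) k p)

  cost-empty : ∀ y k (p : Path (downsUps x y k) (replicate k 0)) →
               cost (downsUps x y k) (replicate k 0) p ≡ 0
  cost-empty y zero    p           = cost-emptyUps x p
  cost-empty y (suc k) (v , i , p) with zeros-unique k v i
  ... | refl = cong₂ _+_
        (trans (cong (suc y *_) (n∸n≡0 (sum (replicate k 0)))) (*-zeroʳ (suc y)))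
        (cost-empty (suc y) k p)

  paths≃mult : ∀ y k → cost (ups x (downs y k)) (replicate k 0) ≃ size (cells x y k)
  paths≃mult y k = ≃-trans (ups-downs x y k (replicate k 0)) record
    { to      = proj₁
    ; from    = _, empty y k
    ; to-from = λ _ → refl
    ; from-to = λ (a , p) → cong (a ,_) (empty-unique y k p)
    ; weight  = λ (a , p) → sym (trans (cong (size (cells x y k) a +_) (cost-empty y k p))
                                       (+-identityʳ _))
    }

-- Diagonals of arrays

Σ-cong : ∀ N {f g : ℕ → ℕ} → (∀ i → i < N → f i ≡ g i) → Σ< N f ≡ Σ< N g
Σ-cong zero    e = refl
Σ-cong (suc N) e = cong₂ _+_ (e 0 z<s) (Σ-cong N (λ i → e (suc i) ∘ s<s))

Σ-zero : ∀ N {f : ℕ → ℕ} → (∀ i → f i ≡ 0) → Σ< N f ≡ 0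
Σ-zero zero    e = refl
Σ-zero (suc N) e = cong₂ _+_ (e 0) (Σ-zero N (e ∘ suc))

Σ-support : ∀ {N M} {f : ℕ → ℕ} → N ≤ M → (∀ i → N ≤ i → f i ≡ 0) → Σ< M f ≡ Σ< N f
Σ-support {M = M}   z≤n       e = Σ-zero M (λ i → e i z≤n)
Σ-support {f = f} (s≤s N≤M) e = cong (f 0 +_) (Σ-support N≤M (λ i → e (suc i) ∘ s≤s))

Σ-+ : ∀ N (f g : ℕ → ℕ) → Σ< N (λ i → f i + g i) ≡ Σ< N f + Σ< N g
Σ-+ zero    f g = refl
Σ-+ (suc N) f g = trans (cong (f 0 + g 0 +_) (Σ-+ N (f ∘ suc) (g ∘ suc)))
  (interchange (f 0) (g 0) (Σ< N (f ∘ suc)) (Σ< N (g ∘ suc)))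
  where
  interchange : ∀ a b c d → a + b + (c + d) ≡ a + c + (b + d)
  interchange = solve-∀

Σ-swap : ∀ N M (f : ℕ → ℕ → ℕ) → Σ< N (λ i → Σ< M (f i)) ≡ Σ< M (λ j → Σ< N (λ i → f i j))
Σ-swap zero    M f = sym (Σ-zero M (λ _ → refl))
Σ-swap (suc N) M f = trans (cong (Σ< M (f 0) +_) (Σ-swap N M (f ∘ suc)))
  (sym (Σ-+ M (f 0) (λ j → Σ< N (λ i → f (suc i) j))))

Σ-++ : ∀ N M (f : ℕ → ℕ) → Σ< (N + M) f ≡ Σ< N f + Σ< M (λ i → f (N + i))
Σ-++ zero    M f = refl
Σ-++ (suc N) M f = trans (cong (f 0 +_) (Σ-++ N M (f ∘ suc))) (sym (+-assoc (f 0) _ _))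

Σ-last : ∀ N (f : ℕ → ℕ) → Σ< (suc N) f ≡ Σ< N f + f N
Σ-last zero    f = +-identityʳ (f 0)
Σ-last (suc N) f = trans (cong (f 0 +_) (Σ-last N (f ∘ suc))) (sym (+-assoc (f 0) _ _))

Σ-reverse : ∀ N (f : ℕ → ℕ) → Σ< N (λ c → f (N ∸ c)) ≡ Σ< N (f ∘ suc)
Σ-reverse zero    f = refl
Σ-reverse (suc N) f = trans (cong (f (suc N) +_) (Σ-reverse N f))
  (trans (+-comm (f (suc N)) _) (sym (Σ-last N (f ∘ suc))))

Σ-term : ∀ {N i} (f : ℕ → ℕ) → i < N → f i ≤ Σ< N f
Σ-term {suc N} {zero}  f _         = m≤m+n _ _
Σ-term {suc N} {suc i} f (s≤s i<N) = ≤-trans (Σ-term (f ∘ suc) i<N) (m≤n+m _ (f 0))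

Σ-positive : ∀ {N M} (f : ℕ → ℕ) → N ≤ M → (∀ i → i < N → 1 ≤ f i) → N ≤ Σ< M f
Σ-positive f z≤n       p = z≤n
Σ-positive f (s≤s N≤M) p = +-mono-≤ (p 0 z<s) (Σ-positive (f ∘ suc) N≤M (λ i → p (suc i) ∘ s<s))

Supported : ℕ → Array → Set
Supported N π = ∀ i j → N ≤ i ⊎ N ≤ j → π i j ≡ 0

boxSum-supported : ∀ {N M} {π : Array} → N ≤ M → Supported N π → boxSum π M ≡ boxSum π N
boxSum-supported {N} {M} N≤M e = trans
  (Σ-support N≤M (λ i N≤i → Σ-zero M (λ j → e i j (inj₁ N≤i))))
  (Σ-cong N (λ i _ → Σ-support N≤M (λ j N≤j → e i j (inj₂ N≤j))))

antitone : ∀ {f : ℕ → ℕ} → (∀ i → f (suc i) ≤ f i) → ∀ {i k} → i ≤′ k → f k ≤ f i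
antitone d ≤′-refl       = ≤-refl
antitone d (≤′-step i≤k) = ≤-trans (d _) (antitone d i≤k)

module _ {n} (p : PlanePartition n) where

  open PlanePartition p

  private
    module Box (i j : ℕ) (1≤π : 1 ≤ π i j) where

      M : ℕ
      M = proj₁ has-sum ⊔ (suc i ⊔ suc j)

      sum≡n : boxSum π M ≡ n
      sum≡n = proj₂ has-sum M (m≤m⊔n _ _)

      i<M : suc i ≤ M
      i<M = ≤-trans (m≤m⊔n (suc i) (suc j)) (m≤n⊔m (proj₁ has-sum) _)

      j<M : suc j ≤ M
      j<M = ≤-trans (m≤n⊔m (suc i) (suc j)) (m≤n⊔m (proj₁ has-sum) _)

      i<n : i < n
      i<n = subst (suc i ≤_) sum≡n (Σ-positive (λ k → Σ< M (π k)) i<M λ k k≤i →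
        ≤-trans 1≤π (≤-trans (antitone (λ l → col-weakly l j) (≤⇒≤′ (s≤s⁻¹ k≤i)))
                             (Σ-term (π k) j<M)))

      j<n : j < n
      j<n = subst (suc j ≤_) sum≡n (≤-trans
        (Σ-positive (π i) j<M λ l l≤j →
          ≤-trans 1≤π (antitone (row-weakly i) (≤⇒≤′ (s≤s⁻¹ l≤j))))
        (Σ-term (λ k → Σ< M (π k)) i<M))

  planePartition-supported : Supported n π
  planePartition-supported i j (inj₁ n≤i) =
    n<1⇒n≡0 (≰⇒> λ 1≤π → <⇒≱ (Box.i<n i j 1≤π) n≤i)
  planePartition-supported i j (inj₂ n≤j) =
    n<1⇒n≡0 (≰⇒> λ 1≤π → <⇒≱ (Box.j<n i j 1≤π) n≤j)

  boxSum-planePartition : ∀ {N} → n ≤ N → boxSum π N ≡ n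
  boxSum-planePartition {N} n≤N = begin
    boxSum π N                     ≡⟨ boxSum-supported n≤N planePartition-supported ⟩
    boxSum π n                     ≡⟨ boxSum-supported (m≤n⊔m (proj₁ has-sum) n)
                                        planePartition-supported ⟨
    boxSum π (proj₁ has-sum ⊔ n)   ≡⟨ proj₂ has-sum _ (m≤m⊔n _ n) ⟩
    n                              ∎
    where open ≡-Reasoning

-- Summing a box along hooks with corners on the diagonal.
boxSum-hooks : ∀ {M K} (π : Array) → M ≤ K → Supported M π → boxSum π M ≡
  Σ< M (λ i → Σ< K (λ e → π (i + suc e) i) + Σ< K (λ k → π i (i + k)))
boxSum-hooks {zero}          π M≤K e = refl
boxSum-hooks {suc M} {K} π M≤K e = begin
  Σ< (suc M) (π 0) + Σ< M (λ i → π (suc i) 0 + Σ< M (π (suc i) ∘ suc))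
    ≡⟨ cong (Σ< (suc M) (π 0) +_) (Σ-+ M (λ i → π (suc i) 0) (λ i → Σ< M (π (suc i) ∘ suc))) ⟩
  Σ< (suc M) (π 0) + (Σ< M (λ i → π (suc i) 0) + boxSum π′ M)
    ≡⟨ rearrange (Σ< (suc M) (π 0)) (Σ< M (λ i → π (suc i) 0)) (boxSum π′ M) ⟩
  Σ< M (λ i → π (suc i) 0) + Σ< (suc M) (π 0) + boxSum π′ M
    ≡⟨ cong₂ _+_ (cong₂ _+_ (sym (Σ-support (≤-trans (n≤1+n M) M≤K) (λ i M≤i → e (suc i) 0 (inj₁ (s≤s M≤i)))))
                            (sym (Σ-support M≤K (λ j M≤j → e 0 j (inj₂ M≤j)))))
                 (boxSum-hooks π′ (≤-trans (n≤1+n M) M≤K) e′) ⟩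
  Σ< K (λ e → π (suc e) 0) + Σ< K (π 0)
    + Σ< M (λ i → Σ< K (λ e → π′ (i + suc e) i) + Σ< K (λ k → π′ i (i + k))) ∎
  where
  open ≡-Reasoning
  π′ : Array
  π′ i j = π (suc i) (suc j)
  e′ : Supported M π′
  e′ i j (inj₁ M≤i) = e (suc i) (suc j) (inj₁ (s≤s M≤i))
  e′ i j (inj₂ M≤j) = e (suc i) (suc j) (inj₂ (s≤s M≤j))
  rearrange : ∀ a b c → a + (b + c) ≡ b + a + c
  rearrange = solve-∀

-- The diagonals of an array, from the lower left to the upper right; the main
-- diagonal has index N.
diagonal : ℕ → Array → ℕ → ℕ → ℕ
diagonal N π c i = π (i + (N ∸ c)) (i + (c ∸ N))

-- For `i` beyond `N + j` the truncated index is 0, and `start` makes that diagonal zero, so entries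
-- far below the main diagonal need no separate clause.
fromDiagonals : ℕ → (ℕ → ℕ → ℕ) → Array
fromDiagonals N s i j = s (N + j ∸ i) (i ⊓ j)

diagonal-below : ∀ N π k i → k ≤ N → diagonal N π (N ∸ k) i ≡ π (i + k) i
diagonal-below N π k i k≤N = cong₂ π
  (cong (i +_) (m∸[m∸n]≡n k≤N))
  (trans (cong (i +_) (m≤n⇒m∸n≡0 (m∸n≤m N k))) (+-identityʳ i))

diagonal-above : ∀ N π k i → diagonal N π (N + k) i ≡ π i (i + k)
diagonal-above N π k i = cong₂ π
  (trans (cong (i +_) (m≤n⇒m∸n≡0 (m≤m+n N k))) (+-identityʳ i))
  (cong (i +_) (m+n∸m≡n N k))

fromDiagonals-below : ∀ N s k j → fromDiagonals N s (j + k) j ≡ s (N ∸ k) j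
fromDiagonals-below N s k j = cong₂ s
  (trans (cong (_∸ (j + k)) (+-comm N j)) ([m+n]∸[m+o]≡n∸o j N k))
  (m≥n⇒m⊓n≡n (m≤m+n j k))

fromDiagonals-above : ∀ N s k i → fromDiagonals N s i (i + k) ≡ s (N + k) i
fromDiagonals-above N s k i = cong₂ s
  (trans (cong (_∸ i) (lemma N i k)) (m+n∸m≡n i (N + k)))
  (m≤n⇒m⊓n≡m (m≤m+n i k))
  where
  lemma : ∀ N i k → N + (i + k) ≡ i + (N + k)
  lemma = solve-∀

data Side : ℕ → ℕ → Set where
  lower : ∀ j k → Side (j + k) j
  upper : ∀ i k → Side i (i + suc k)

side : ∀ i j → Side i j
side zero    zero    = lower 0 0
side zero    (suc j) = upper 0 j
side (suc i) zero    = lower 0 (suc i)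
side (suc i) (suc j) with side i j
... | lower j k = lower (suc j) k
... | upper i k = upper (suc i) k

record Diagonals (N : ℕ) (s : ℕ → ℕ → ℕ) : Set where
  field
    start   : ∀ i → s 0 i ≡ 0
    finish  : ∀ k i → N ≤ k → s (N + k) i ≡ 0
    rising  : ∀ c i → c < N → s c i ≤ s (suc c) i × s (suc c) (suc i) ≤ s c i
    falling : ∀ k i → s (N + suc k) i ≤ s (N + k) i × s (N + k) (suc i) ≤ s (N + suc k) i

  -- By interlacing, each rising step makes at most one more entry nonzero, starting from none.
  -- `vanishesʳ` does the same count backwards from `finish`.
  vanishesˡ : ∀ c i → c ≤ N → c ≤ i → s c i ≡ 0
  vanishesˡ zero    i       _   _         = start i
  vanishesˡ (suc c) (suc i) c<N (s≤s c≤i) =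
    n≤0⇒n≡0 (≤-trans (proj₂ (rising c i c<N)) (≤-reflexive (vanishesˡ c i (<⇒≤ c<N) c≤i)))

  vanishesʳ : ∀ k i → N ≤ k + i → s (N + k) i ≡ 0
  vanishesʳ k zero    h = finish k 0 (subst (N ≤_) (+-identityʳ k) h)
  vanishesʳ k (suc i) h = n≤0⇒n≡0 (≤-trans (proj₂ (falling k i))
    (≤-reflexive (vanishesʳ (suc k) i (subst (N ≤_) (+-suc k i) h))))

open Diagonals

Decreasing : Array → Set
Decreasing π = ∀ i j → π i (suc j) ≤ π i j × π (suc i) j ≤ π i j

diagonals : ∀ {N π} → Supported N π → Decreasing π → Diagonals N (diagonal N π)
diagonals {N} {π} supp dec = record
  { start   = λ i → supp (i + N) _ (inj₁ (m≤n+m N i))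
  ; finish  = λ k i N≤k → trans (diagonal-above N π k i)
      (supp i (i + k) (inj₂ (≤-trans N≤k (m≤n+m k i))))
  ; rising  = λ c i c<N → up-step i c<N (N ∸ suc c) refl
  ; falling = λ k i →
        subst₂ _≤_ (sym (trans (diagonal-above N π (suc k) i) (cong (π i) (+-suc i k))))
                   (sym (diagonal-above N π k i)) (proj₁ (dec i (i + k)))
      , subst₂ _≤_ (sym (diagonal-above N π k (suc i)))
                   (sym (trans (diagonal-above N π (suc k) i) (cong (π i) (+-suc i k))))
                   (proj₂ (dec i (suc (i + k))))
  }
  where
  up-step : ∀ {c} i → c < N → ∀ e → N ∸ suc c ≡ e →
            diagonal N π c i ≤ diagonal N π (suc c) i
            × diagonal N π (suc c) (suc i) ≤ diagonal N π c i
  up-step {c} i c<N e refl =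
      subst₂ _≤_ (sym s≡) (sym (s′≡ i)) (proj₂ (dec (i + e) i))
    , subst₂ _≤_ (sym (s′≡ (suc i))) (sym s≡) (proj₁ (dec (suc (i + e)) i))
    where
    s≡ : diagonal N π c i ≡ π (suc (i + e)) i
    s≡ = cong₂ π
      (trans (cong (i +_) (+-∸-assoc 1 c<N)) (+-suc i e))
      (trans (cong (i +_) (m≤n⇒m∸n≡0 (<⇒≤ c<N))) (+-identityʳ i))
    s′≡ : ∀ i → diagonal N π (suc c) i ≡ π (i + e) i
    s′≡ i = cong (π (i + e)) (trans (cong (i +_) (m≤n⇒m∸n≡0 c<N)) (+-identityʳ i))

module _ {N s} (D : Diagonals N s) where

  fromDiagonals-decreasing : Decreasing (fromDiagonals N s)
  fromDiagonals-decreasing i j = right i j (side i j) , lower-right i j (side i j)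
    where
    π = fromDiagonals N s

    step : ∀ k i → s (N ∸ suc k) i ≤ s (N ∸ k) i × s (N ∸ k) (suc i) ≤ s (N ∸ suc k) i
    step k i with k <? N
    ... | yes k<N = subst (λ c → s (N ∸ suc k) i ≤ s c i × s c (suc i) ≤ s (N ∸ suc k) i)
                      (sym (+-∸-assoc 1 k<N)) (rising D (N ∸ suc k) i N∸1+k<N)
      where
      N∸1+k<N : N ∸ suc k < N
      N∸1+k<N = subst (_≤ N) (+-∸-assoc 1 k<N) (m∸n≤m N k)
    -- Both indices truncate to 0, where all entries are zero.
    ... | no  k≮N with m≤n⇒m∸n≡0 (≮⇒≥ k≮N) | m≤n⇒m∸n≡0 (m≤n⇒m≤1+n (≮⇒≥ k≮N))
    ...   | e | e′ rewrite e | e′ = ≤-refl , ≤-trans (≤-reflexive (start D (suc i))) z≤n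

    right : ∀ i j → Side i j → π i (suc j) ≤ π i j
    right _ j (lower j zero) = subst₂ _≤_
      (sym (trans (cong₂ π (+-identityʳ j) (sym (+-comm j 1))) (fromDiagonals-above N s 1 j)))
      (sym (trans (fromDiagonals-below N s 0 j) (cong (λ c → s c j) (sym (+-identityʳ N)))))
      (proj₁ (falling D 0 j))
    right _ j (lower j (suc k)) = subst₂ _≤_
      (sym (trans (cong (λ i → π i (suc j)) (+-suc j k)) (fromDiagonals-below N s k (suc j))))
      (sym (fromDiagonals-below N s (suc k) j))
      (proj₂ (step k j))
    right i _ (upper i k) = subst₂ _≤_
      (sym (trans (cong (π i) (sym (+-suc i (suc k)))) (fromDiagonals-above N s (suc (suc k)) i)))
      (sym (fromDiagonals-above N s (suc k) i))
      (proj₁ (falling D (suc k) i))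

    lower-right : ∀ i j → Side i j → π (suc i) j ≤ π i j
    lower-right _ j (lower j k) = subst₂ _≤_
      (sym (trans (cong (λ i → π i j) (sym (+-suc j k))) (fromDiagonals-below N s (suc k) j)))
      (sym (fromDiagonals-below N s k j))
      (proj₁ (step k j))
    lower-right i _ (upper i k) = subst₂ _≤_
      (sym (trans (cong (π (suc i)) (+-suc i k)) (fromDiagonals-above N s k (suc i))))
      (sym (fromDiagonals-above N s (suc k) i))
      (proj₂ (falling D k i))

  fromDiagonals-supported : Supported N (fromDiagonals N s)
  fromDiagonals-supported i j h with side i j
  ... | lower j k = trans (fromDiagonals-below N s k j) (vanish (side′ h))
    where
    side′ : N ≤ j + k ⊎ N ≤ j → N ≤ k + j
    side′ (inj₁ N≤) = subst (N ≤_) (+-comm j k) N≤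
    side′ (inj₂ N≤) = ≤-trans N≤ (m≤n+m j k)
    vanish : N ≤ k + j → s (N ∸ k) j ≡ 0
    vanish N≤ = vanishesˡ D (N ∸ k) j (m∸n≤m N k) (m≤n+o⇒m∸n≤o N k N≤)
  ... | upper i k = trans (fromDiagonals-above N s (suc k) i)
                          (vanishesʳ D (suc k) i (side′ h))
    where
    side′ : N ≤ i ⊎ N ≤ i + suc k → N ≤ suc k + i
    side′ (inj₁ N≤) = ≤-trans N≤ (m≤n+m i (suc k))
    side′ (inj₂ N≤) = subst (N ≤_) (+-comm i (suc k)) N≤

  diagonal-fromDiagonals : ∀ c i → diagonal N (fromDiagonals N s) c i ≡ s c i
  diagonal-fromDiagonals c i with ≤-total c N
  ... | inj₁ c≤N = begin
    diagonal N π c i             ≡⟨ cong (λ c → diagonal N π c i) (m∸[m∸n]≡n c≤N) ⟨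
    diagonal N π (N ∸ (N ∸ c)) i ≡⟨ diagonal-below N π (N ∸ c) i (m∸n≤m N c) ⟩
    π (i + (N ∸ c)) i            ≡⟨ fromDiagonals-below N s (N ∸ c) i ⟩
    s (N ∸ (N ∸ c)) i            ≡⟨ cong (λ c → s c i) (m∸[m∸n]≡n c≤N) ⟩
    s c i                        ∎
    where
    open ≡-Reasoning
    π = fromDiagonals N s
  ... | inj₂ N≤c = begin
    diagonal N π c i             ≡⟨ cong (λ c → diagonal N π c i) (m+[n∸m]≡n N≤c) ⟨
    diagonal N π (N + (c ∸ N)) i ≡⟨ diagonal-above N π (c ∸ N) i ⟩
    π i (i + (c ∸ N))            ≡⟨ fromDiagonals-above N s (c ∸ N) i ⟩
    s (N + (c ∸ N)) i            ≡⟨ cong (λ c → s c i) (m+[n∸m]≡n N≤c) ⟩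
    s c i                        ∎
    where
    open ≡-Reasoning
    π = fromDiagonals N s

fromDiagonals-diagonal : ∀ {N π} → Supported N π → ∀ i j →
                         fromDiagonals N (diagonal N π) i j ≡ π i j
fromDiagonals-diagonal {N} {π} supp i j with side i j
... | upper i k = trans (fromDiagonals-above N (diagonal N π) (suc k) i)
                        (diagonal-above N π (suc k) i)
... | lower j k with ≤-total k N
...   | inj₁ k≤N = trans (fromDiagonals-below N (diagonal N π) k j) (diagonal-below N π k j k≤N)
...   | inj₂ N≤k = trans (fromDiagonals-below N (diagonal N π) k j) (trans
          (supp _ _ (inj₁ (subst (N ≤_) (cong (λ z → j + (N ∸ z)) (sym (m≤n⇒m∸n≡0 N≤k))) (m≤n+m N j))))
          (sym (supp (j + k) j (inj₁ (≤-trans N≤k (m≤n+m k j))))))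

-- Exchanging the order of summation turns diagonals into the legs and arms of the hooks. The main
-- diagonal belongs to the arms, so the offsets below it are 1, ..., N and appear in reverse order.
diagonal-total : ∀ {N π} → Supported N π →
                 Σ< (N + N) (λ c → Σ< N (diagonal N π c)) ≡ boxSum π N
diagonal-total {N} {π} supp = begin
  Σ< (N + N) (λ c → Σ< N (diagonal N π c))
    ≡⟨ Σ-++ N N (λ c → Σ< N (diagonal N π c)) ⟩
  Σ< N (λ c → Σ< N (diagonal N π c)) + Σ< N (λ k → Σ< N (diagonal N π (N + k)))
    ≡⟨ cong₂ _+_ below-total (Σ-cong N (λ k _ → Σ-cong N (λ i _ → diagonal-above N π k i))) ⟩
  Σ< N (λ e → Σ< N (λ i → π (i + suc e) i)) + Σ< N (λ k → Σ< N (λ i → π i (i + k)))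
    ≡⟨ cong₂ _+_ (Σ-swap N N (λ e i → π (i + suc e) i)) (Σ-swap N N (λ k i → π i (i + k))) ⟩
  Σ< N (λ i → Σ< N (λ e → π (i + suc e) i)) + Σ< N (λ i → Σ< N (λ k → π i (i + k)))
    ≡⟨ Σ-+ N (λ i → Σ< N (λ e → π (i + suc e) i)) (λ i → Σ< N (λ k → π i (i + k))) ⟨
  Σ< N (λ i → Σ< N (λ e → π (i + suc e) i) + Σ< N (λ k → π i (i + k)))
    ≡⟨ boxSum-hooks π ≤-refl supp ⟨
  boxSum π N ∎
  where
  open ≡-Reasoning
  below-total : Σ< N (λ c → Σ< N (diagonal N π c)) ≡ Σ< N (λ e → Σ< N (λ i → π (i + suc e) i))
  below-total = trans
    (Σ-cong N (λ c c<N → Σ-cong N (λ i _ → trans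
      (cong (λ c → diagonal N π c i) (sym (m∸[m∸n]≡n (<⇒≤ c<N))))
      (diagonal-below N π (N ∸ c) i (m∸n≤m N c)))))
    (Σ-reverse N (λ k → Σ< N (λ i → π (i + k) i)))

-- Plane partitions as paths

open Diagonals

tabulateℕ : (d : ℕ) → (ℕ → ℕ) → Vec ℕ d
tabulateℕ zero    f = []
tabulateℕ (suc d) f = f 0 ∷ tabulateℕ d (f ∘ suc)

extend-tabulateℕ : ∀ d {f} → (∀ i → d ≤ i → f i ≡ 0) → ∀ i → extend 0 (tabulateℕ d f) i ≡ f i
extend-tabulateℕ zero    e i       = sym (e i z≤n)
extend-tabulateℕ (suc d) e zero    = refl
extend-tabulateℕ (suc d) e (suc i) = extend-tabulateℕ d (λ i → e (suc i) ∘ s≤s) i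

extend-injective : ∀ {d} (u v : Vec ℕ d) → (∀ i → extend 0 u i ≡ extend 0 v i) → u ≡ v
extend-injective []      []      e = refl
extend-injective (a ∷ u) (b ∷ v) e = cong₂ _∷_ (e 0) (extend-injective u v (e ∘ suc))

extend-replicate : ∀ d i → extend 0 (replicate d 0) i ≡ 0
extend-replicate zero    i       = refl
extend-replicate (suc d) zero    = refl
extend-replicate (suc d) (suc i) = extend-replicate d i

sum-extend : ∀ {d M} (u : Vec ℕ d) → d ≤ M → sum u ≡ Σ< M (extend 0 u)
sum-extend {M = M} []      _         = sym (Σ-zero M (λ _ → refl))
sum-extend         (a ∷ u) (s≤s d≤M) = cong (a +_) (sum-extend u d≤M)

tabulate-▷ : ∀ d {f g : ℕ → ℕ} → (∀ i → g i ≤ f i × f (suc i) ≤ g i) →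
             tabulateℕ (suc d) f ▷ tabulateℕ d g
tabulate-▷ zero    h = tt
tabulate-▷ (suc d) h = proj₁ (h 0) , proj₂ (h 0) , tabulate-▷ d (h ∘ suc)

tabulate-▶ : ∀ d {f g : ℕ → ℕ} → (∀ i → g i ≤ f i × f (suc i) ≤ g i) →
             tabulateℕ d f ▶ tabulateℕ d g
tabulate-▶ zero          h = tt
tabulate-▶ (suc zero)    h = proj₁ (h 0)
tabulate-▶ (suc (suc d)) h = proj₁ (h 0) , proj₂ (h 0) , tabulate-▶ (suc d) (h ∘ suc)

▷-extend : ∀ {d} (u : Vec ℕ (suc d)) (v : Vec ℕ d) → u ▷ v → ∀ i →
           extend 0 v i ≤ extend 0 u i × extend 0 u (suc i) ≤ extend 0 v i
▷-extend (_ ∷ [])    []      _           i       = z≤n , z≤n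
▷-extend (_ ∷ b ∷ u) (_ ∷ v) (p , q , r) zero    = p , q
▷-extend (_ ∷ b ∷ u) (_ ∷ v) (p , q , r) (suc i) = ▷-extend (b ∷ u) v r i

▶-extend : ∀ {d} (u v : Vec ℕ d) → u ▶ v → ∀ i →
           extend 0 v i ≤ extend 0 u i × extend 0 u (suc i) ≤ extend 0 v i
▶-extend []          []       _           i       = z≤n , z≤n
▶-extend (_ ∷ [])    (_ ∷ []) p           zero    = p , z≤n
▶-extend (_ ∷ [])    (_ ∷ []) p           (suc i) = z≤n , z≤n
▶-extend (_ ∷ b ∷ u) (_ ∷ v)  (p , q , r) zero    = p , q
▶-extend (_ ∷ b ∷ u) (_ ∷ v)  (p , q , r) (suc i) = ▶-extend (b ∷ u) v r i

slice : ∀ {d} (w : Word d) (u : Vec ℕ d) → Path w u → ℕ → ℕ → ℕ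
slice w          u p           zero    = extend 0 u
slice end        u p           (suc c) = λ _ → 0
slice (up x w)   u (v , _ , p) (suc c) = slice w v p c
slice (down y w) u (v , _ , p) (suc c) = slice w v p c

-- Interlacing proofs are unique, so a path is determined by its partitions.
slice-injective : ∀ {d} (w : Word d) u (p q : Path w u) →
                  (∀ c i → slice w u p c i ≡ slice w u q c i) → p ≡ q
slice-injective end        u p           q             e = refl
slice-injective (up x w)   u (v , i , p) (v′ , i′ , q) e with extend-injective v v′ (e 1)
... | refl = cong₂ (λ i p → v , i , p) (▶-irrelevant v u i i′)
                   (slice-injective w v p q (e ∘ suc))
slice-injective (down y w) u (v , i , p) (v′ , i′ , q) e with extend-injective v v′ (e 1)
... | refl = cong₂ (λ i p → v , i , p) (▷-irrelevant u v i i′)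
                   (slice-injective w v p q (e ∘ suc))

-- The partitions along a path are vectors of varying lengths; comparing their extensions by zero
-- avoids transport between lengths.
record PathAlong {d} (w : Word d) (u : Vec ℕ d) (s : ℕ → ℕ → ℕ) : Set where
  constructor _,_
  field
    path    : Path w u
    slices≡ : ∀ c i → slice w u path c i ≡ s c i

open PathAlong

module _ {N s} (D : Diagonals N s) where

  private
    -- By `vanishesʳ` the diagonal `N + k` has at most m = N - k nonzero entries, so cutting it to
    -- `m` parts loses nothing.
    downPath : ∀ m k → k + m ≡ N →
               PathAlong (downs k m) (tabulateℕ m (s (N + k))) (λ c → s (N + k + c))
    downPath zero    k e = tt , slices
      where
      vanish : ∀ c i → s (N + k + c) i ≡ 0
      vanish c i = trans (cong (λ c → s c i) (+-assoc N k c))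
        (finish D (k + c) i (≤-trans (≤-reflexive (trans (sym e) (+-identityʳ k))) (m≤m+n k c)))
      slices : ∀ c i → slice end [] tt c i ≡ s (N + k + c) i
      slices zero    i = sym (vanish 0 i)
      slices (suc c) i = sym (vanish (suc c) i)
    downPath (suc m) k e with downPath m (suc k) (trans (sym (+-suc k m)) e)
    ... | p , p≡ = q , slices
      where
      q : Path (downs k (suc m)) (tabulateℕ (suc m) (s (N + k)))
      q = tabulateℕ m (s (N + suc k)) , tabulate-▷ m (falling D k) , p
      vanish : ∀ i → suc m ≤ i → s (N + k) i ≡ 0
      vanish i h = vanishesʳ D k i (subst (_≤ k + i) e (+-monoʳ-≤ k h))
      shuffle : ∀ N k c → N + suc k + c ≡ N + k + suc c
      shuffle = solve-∀
      slices : ∀ c i → slice (downs k (suc m)) _ q c i ≡ s (N + k + c) i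
      slices zero    i = trans (extend-tabulateℕ (suc m) vanish i)
                               (cong (λ c → s c i) (sym (+-identityʳ (N + k))))
      slices (suc c) i = trans (p≡ c i) (cong (λ c → s c i) (shuffle N k c))

    upPath : ∀ x c → c + x ≡ N →
             PathAlong (ups x (downs 0 N)) (tabulateℕ N (s c)) (λ e → s (c + e))
    upPath zero    c e with trans (sym (+-identityʳ c)) e
    ... | refl = subst (λ k → PathAlong (downs 0 N) (tabulateℕ N (s k)) (λ e → s (k + e)))
                       (+-identityʳ c) (downPath N 0 refl)
    upPath (suc x) c e with upPath x (suc c) (trans (sym (+-suc c x)) e)
    ... | p , p≡ = q , slices
      where
      c<N : c < N
      c<N = subst (suc c ≤_) (trans (sym (+-suc c x)) e) (m≤m+n (suc c) x)
      vanish : ∀ i → N ≤ i → s c i ≡ 0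
      vanish i N≤i = vanishesˡ D c i (<⇒≤ c<N) (≤-trans (<⇒≤ c<N) N≤i)
      q : Path (ups (suc x) (downs 0 N)) (tabulateℕ N (s c))
      q = tabulateℕ N (s (suc c)) , tabulate-▶ N (λ i → rising D c i c<N) , p
      slices : ∀ k i → slice (ups (suc x) (downs 0 N)) _ q k i ≡ s (c + k) i
      slices zero    i = trans (extend-tabulateℕ N vanish i)
                               (cong (λ c → s c i) (sym (+-identityʳ c)))
      slices (suc k) i = trans (p≡ k i) (cong (λ c → s c i) (sym (+-suc c k)))

  diagonalsPath : PathAlong (ups N (downs 0 N)) (replicate N 0) s
  diagonalsPath = subst (λ u → PathAlong (ups N (downs 0 N)) u s)
    (extend-injective (tabulateℕ N (s 0)) (replicate N 0) λ i → trans
      (extend-tabulateℕ N (λ i _ → start D i) i)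
      (trans (start D i) (sym (extend-replicate N i))))
    (upPath N 0 refl)

slice-falling : ∀ y k u (p : Path (downs y k) u) c i →
  slice (downs y k) u p (suc c) i ≤ slice (downs y k) u p c i ×
  slice (downs y k) u p c (suc i) ≤ slice (downs y k) u p (suc c) i
slice-falling y zero    [] p           zero    i = z≤n , z≤n
slice-falling y zero    u  p           (suc c) i = z≤n , z≤n
slice-falling y (suc k) u  (v , h , p) zero    i = ▷-extend u v h i
slice-falling y (suc k) u  (v , h , p) (suc c) i = slice-falling (suc y) k v p c i

slice-finish : ∀ y k u (p : Path (downs y k) u) c i → k ≤ c → slice (downs y k) u p c i ≡ 0
slice-finish y zero    [] p           zero    i _         = refl
slice-finish y zero    u  p           (suc c) i _         = refl
slice-finish y (suc k) u  (v , h , p) (suc c) i (s≤s k≤c) = slice-finish (suc y) k v p c i k≤c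

slice-rising : ∀ {d} x (w : Word d) u (p : Path (ups x w) u) c i → c < x →
  slice (ups x w) u p c i ≤ slice (ups x w) u p (suc c) i ×
  slice (ups x w) u p (suc c) (suc i) ≤ slice (ups x w) u p c i
slice-rising (suc x) w u (v , h , p) zero    i _         = ▶-extend v u h i
slice-rising (suc x) w u (v , h , p) (suc c) i (s≤s c<x) = slice-rising x w v p c i c<x

top : ∀ {d} x (w : Word d) u → Path (ups x w) u → Σ (Vec ℕ d) (Path w)
top zero    w u p           = u , p
top (suc x) w u (v , _ , p) = top x w v p

slice-top : ∀ {d} x (w : Word d) u p c i →
  slice (ups x w) u p (x + c) i ≡ slice w (proj₁ (top x w u p)) (proj₂ (top x w u p)) c i
slice-top zero    w u p           c i = refl
slice-top (suc x) w u (v , _ , p) c i = slice-top x w v p c i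

pathDiagonals : ∀ N (p : Path (ups N (downs 0 N)) (replicate N 0)) →
                Diagonals N (slice (ups N (downs 0 N)) (replicate N 0) p)
pathDiagonals N p = record
  { start   = extend-replicate N
  ; finish  = λ k i N≤k → trans (at k i) (slice-finish 0 N _ q k i N≤k)
  ; rising  = slice-rising N (downs 0 N) (replicate N 0) p
  ; falling = λ k i → let (a , b) = slice-falling 0 N _ q k i in
        subst₂ _≤_ (sym (at (suc k) i)) (sym (at k i)) a
      , subst₂ _≤_ (sym (at k (suc i))) (sym (at (suc k) i)) b
  }
  where
  q = proj₂ (top N (downs 0 N) (replicate N 0) p)
  at = slice-top N (downs 0 N) (replicate N 0) p

-- The cost of a path as the sum of its partitions

steps : ∀ {d} → Word d → ℕ
steps end        = 0
steps (up _ w)   = suc (steps w)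
steps (down _ w) = suc (steps w)

steps-downs : ∀ y k → steps (downs y k) ≡ k
steps-downs y zero    = refl
steps-downs y (suc k) = cong suc (steps-downs (suc y) k)

steps-ups : ∀ {d} x (w : Word d) → steps (ups x w) ≡ x + steps w
steps-ups zero    w = refl
steps-ups (suc x) w = cong suc (steps-ups x w)

-- Each step counts the partition before it. The last partition has no parts and adds nothing.
area : ∀ {d} (w : Word d) (u : Vec ℕ d) → Path w u → ℕ
area end        u _           = 0
area (up x w)   u (v , _ , p) = sum u + area w v p
area (down y w) u (v , _ , p) = sum u + area w v p

area-slices : ∀ {d M} (w : Word d) u p → d ≤ M →
              area w u p ≡ Σ< (steps w) (λ c → Σ< M (slice w u p c))
area-slices end        u p           d≤M = refl
area-slices (up x w)   u (v , _ , p) d≤M = cong₂ _+_ (sum-extend u d≤M) (area-slices w v p d≤M)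
area-slices (down y w) u (v , _ , p) d≤M =
  cong₂ _+_ (sum-extend u d≤M) (area-slices w v p (≤-trans (n≤1+n _) d≤M))

-- Summation by parts: the weights of downs y k are y + 1, y + 2, …
cost-downs : ∀ y k u p → cost (downs y k) u p ≡ y * sum u + area (downs y k) u p
cost-downs y zero    [] p           = sym (trans (+-identityʳ _) (*-zeroʳ y))
cost-downs y (suc k) u  (v , h , p) = begin
  suc y * (sum u ∸ sum v) + cost (downs (suc y) k) v p
    ≡⟨ cong (suc y * (sum u ∸ sum v) +_) (cost-downs (suc y) k v p) ⟩
  suc y * (sum u ∸ sum v) + (suc y * sum v + A)
    ≡⟨ +-assoc (suc y * (sum u ∸ sum v)) _ _ ⟨
  suc y * (sum u ∸ sum v) + suc y * sum v + A
    ≡⟨ cong (_+ A) (*-distribˡ-+ (suc y) (sum u ∸ sum v) (sum v)) ⟨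
  suc y * (sum u ∸ sum v + sum v) + A
    ≡⟨ cong (λ z → suc y * z + A) (m∸n+n≡m (▷⇒sum≤ u v h)) ⟩
  suc y * sum u + A ≡⟨ rearrange (sum u) (y * sum u) A ⟩
  y * sum u + (sum u + A) ∎
  where
  open ≡-Reasoning
  A = area (downs (suc y) k) v p
  rearrange : ∀ a b c → a + b + c ≡ b + (a + c)
  rearrange = solve-∀

-- An up step is weighted by the number of later partitions strictly before the peak. The peak is
-- counted with the down steps, which is why the up weights end at 0 and the down weights start at
-- 1. The term `x * sum u` is the share of the initial partition.
cost-ups : ∀ k x u p → cost (ups x (downs 0 k)) u p + x * sum u ≡ area (ups x (downs 0 k)) u p
cost-ups k zero    u p           = trans (+-identityʳ _) (cost-downs 0 k u p)
cost-ups k (suc x) u (v , h , p) = begin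
  x * (sum v ∸ sum u) + C + (sum u + x * sum u)
    ≡⟨ rearrange (x * (sum v ∸ sum u)) C (sum u) (x * sum u) ⟩
  sum u + (C + (x * (sum v ∸ sum u) + x * sum u))
    ≡⟨ cong (λ z → sum u + (C + z)) (*-distribˡ-+ x (sum v ∸ sum u) (sum u)) ⟨
  sum u + (C + x * (sum v ∸ sum u + sum u))
    ≡⟨ cong (λ z → sum u + (C + x * z)) (m∸n+n≡m (▶⇒sum≤ v u h)) ⟩
  sum u + (C + x * sum v)
    ≡⟨ cong (sum u +_) (cost-ups k x v p) ⟩
  sum u + area (ups x (downs 0 k)) v p ∎
  where
  open ≡-Reasoning
  C = cost (ups x (downs 0 k)) v p
  rearrange : ∀ a b c d → a + b + (c + d) ≡ c + (b + (a + d))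
  rearrange = solve-∀

sum-replicate : ∀ N → sum (replicate N 0) ≡ 0
sum-replicate zero    = refl
sum-replicate (suc N) = sum-replicate N

module _ (N : ℕ) where

  private
    W = ups N (downs 0 N)
    ∅ = replicate N 0

  cost≡boxSum : ∀ (p : Path W ∅) → cost W ∅ p ≡ boxSum (fromDiagonals N (slice W ∅ p)) N
  cost≡boxSum p = begin
    cost W ∅ p                  ≡⟨ +-identityʳ _ ⟨
    cost W ∅ p + 0              ≡⟨ cong (cost W ∅ p +_) (*-zeroʳ N) ⟨
    cost W ∅ p + N * 0          ≡⟨ cong (λ z → cost W ∅ p + N * z) (sum-replicate N) ⟨
    cost W ∅ p + N * sum ∅      ≡⟨ cost-ups N N ∅ p ⟩
    area W ∅ p                  ≡⟨ area-slices W ∅ p ≤-refl ⟩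
    Σ< (steps W) (λ c → Σ< N (slice W ∅ p c))
      ≡⟨ cong (λ L → Σ< L (λ c → Σ< N (slice W ∅ p c)))
              (trans (steps-ups N (downs 0 N)) (cong (N +_) (steps-downs 0 N))) ⟩
    Σ< (N + N) (λ c → Σ< N (slice W ∅ p c))
      ≡⟨ Σ-cong (N + N) (λ c _ → Σ-cong N (λ i _ → diagonal-fromDiagonals D c i)) ⟨
    Σ< (N + N) (λ c → Σ< N (diagonal N (fromDiagonals N (slice W ∅ p)) c))
      ≡⟨ diagonal-total (fromDiagonals-supported D) ⟩
    boxSum (fromDiagonals N (slice W ∅ p)) N ∎
    where
    open ≡-Reasoning
    D = pathDiagonals N p

  private
    toPP : ∀ {n} → Σ (Path W ∅) (λ p → cost W ∅ p ≡ n) → PlanePartition n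
    toPP (p , e) = record
      { π          = fromDiagonals N (slice W ∅ p)
      ; row-weakly = λ i j → proj₁ (fromDiagonals-decreasing D i j)
      ; col-weakly = λ i j → proj₂ (fromDiagonals-decreasing D i j)
      ; has-sum    = N , λ M N≤M → trans
          (boxSum-supported N≤M (fromDiagonals-supported D))
          (trans (sym (cost≡boxSum p)) e)
      }
      where D = pathDiagonals N p

    module FromPP {n} (n≤N : n ≤ N) (q : PlanePartition n) where
      open PlanePartition q

      supp : Supported N π
      supp i j (inj₁ N≤i) = planePartition-supported q i j (inj₁ (≤-trans n≤N N≤i))
      supp i j (inj₂ N≤j) = planePartition-supported q i j (inj₂ (≤-trans n≤N N≤j))

      along : PathAlong W ∅ (diagonal N π)
      along = diagonalsPath (diagonals supp (λ i j → row-weakly i j , col-weakly i j))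

      array≡ : ∀ i j → fromDiagonals N (slice W ∅ (path along)) i j ≡ π i j
      array≡ i j = trans (slices≡ along _ _) (fromDiagonals-diagonal supp i j)

      cost≡ : cost W ∅ (path along) ≡ n
      cost≡ = trans (cost≡boxSum (path along)) (trans
        (Σ-cong N (λ i _ → Σ-cong N (λ j _ → array≡ i j)))
        (boxSum-planePartition q n≤N))

  -- A plane partition of `n` vanishes outside the n × n box, hence outside the N × N box, and so
  -- its diagonals form a path of this word.
  pathsInverse : ∀ {n} → n ≤ N →
    Inverse (setoid (Σ (Path W ∅) (λ p → cost W ∅ p ≡ n))) (planePartitions n)
  pathsInverse {n} n≤N = record
    { to        = toPP
    ; from      = fromPP
    ; to-cong   = λ { refl _ _ → refl }
    ; from-cong = λ {q} {q′} → from-cong q q′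
    ; inverse   = (λ { {q} refl → array≡ n≤N q })
                , (λ {p} {q} e → trans (from-cong q (toPP p) e) (fromPP-toPP p))
    }
    where
    open FromPP
    open PlanePartition

    path≡ : ∀ {p p′ : Path W ∅} {e e′} → (∀ c i → slice W ∅ p c i ≡ slice W ∅ p′ c i) →
            _≡_ {A = Σ (Path W ∅) (λ p → cost W ∅ p ≡ n)} (p , e) (p′ , e′)
    path≡ {p} {p′} {refl} {e} h with slice-injective W ∅ p p′ h | e
    ... | refl | refl = refl

    fromPP : PlanePartition n → Σ (Path W ∅) (λ p → cost W ∅ p ≡ n)
    fromPP q = path (along n≤N q) , cost≡ n≤N q

    from-cong : ∀ q q′ → (∀ i j → π q i j ≡ π q′ i j) → fromPP q ≡ fromPP q′
    from-cong q q′ e = path≡ λ c i →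
      trans (slices≡ (along n≤N q) c i) (trans (e _ _) (sym (slices≡ (along n≤N q′) c i)))

    fromPP-toPP : ∀ p → fromPP (toPP p) ≡ p
    fromPP-toPP (p , e) = path≡ λ c i → trans (slices≡ (along n≤N (toPP (p , e))) c i)
      (diagonal-fromDiagonals (pathDiagonals N p) c i)

-- The recurrence for pp

Fiber : {A : Set} → (A → ℕ) → ℕ → Set
Fiber {A} f n = Σ A (λ a → f a ≡ n)

fiber≡ : ∀ {A : Set} {f : A → ℕ} {n} {x y : Fiber f n} → proj₁ x ≡ proj₁ y → x ≡ y
fiber≡ {x = a , refl} {_ , refl} refl = refl

fiber-cong : ∀ {A B : Set} {f : A → ℕ} {g : B → ℕ} → f ≃ g → ∀ n → Fiber f n ↔ Fiber g n
fiber-cong {g = g} e n = mk↔ₛ′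
  (λ (a , p) → to e a , trans (weight e a) p)
  (λ (b , p) → from e b , trans (sym (weight e (from e b))) (trans (cong g (to-from e b)) p))
  (λ (b , p) → fiber≡ (to-from e b))
  (λ (a , p) → fiber≡ (from-to e a))

Conv : (ℕ → Set) → (ℕ → Set) → ℕ → Set
Conv F G n = Σ ℕ λ i → Σ ℕ λ j → i + j ≡ n × F i × G j

conv-zero↔ : ∀ F G → Conv F G 0 ↔ (F 0 × G 0)
conv-zero↔ F G = mk↔ₛ′
  (λ { (zero , zero , _ , x , y) → x , y })
  (λ (x , y) → 0 , 0 , refl , x , y)
  (λ _ → refl)
  (λ { (zero , zero , refl , x , y) → refl })

conv-suc↔ : ∀ F G n → Conv F G (suc n) ↔ (F 0 × G (suc n) ⊎ Conv (F ∘ suc) G n)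
conv-suc↔ F G n = mk↔ₛ′
  (λ { (zero  , _ , refl , x , y) → inj₁ (x , y)
     ; (suc i , j , e    , x , y) → inj₂ (i , j , suc-injective e , x , y) })
  (λ { (inj₁ (x , y))             → 0 , suc n , refl , x , y
     ; (inj₂ (i , j , e , x , y)) → suc i , j , cong suc e , x , y })
  (λ { (inj₁ _)                      → refl
     ; (inj₂ (i , j , refl , x , y)) → refl })
  (λ { (zero  , _ , refl , x , y) → refl
     ; (suc i , j , refl , x , y) → refl })

conv↔ : ∀ {F G f g} → (∀ i → F i ↔ Fin (f i)) → (∀ i → G i ↔ Fin (g i)) →
        ∀ n → Conv F G n ↔ Fin (conv f g n)
conv↔ {F} {G} a b zero    = ↔-trans (conv-zero↔ F G) (↔-trans (a 0 ×-↔ b 0) (↔-sym *↔×))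
conv↔ {F} {G} a b (suc n) = ↔-trans (conv-suc↔ F G n) (↔-trans
  (↔-trans (a 0 ×-↔ b (suc n)) (↔-sym *↔×) ⊎-↔ conv↔ (a ∘ suc) b n)
  (↔-sym +↔⊎))

multiples↔ : ∀ w n → Fiber (multiples w) n ↔ Fin (χ (suc w) n)
multiples↔ w n with suc w ∣? n
... | yes (divides q e) = mk↔ₛ′ (λ _ → Fin.zero) (λ _ → q , sym e)
        (λ { Fin.zero → refl ; (Fin.suc ()) })
        (λ (m , e′) → fiber≡ (*-cancelʳ-≡ q m (suc w) (trans (sym e) (sym e′))))
... | no w∤n = mk↔ₛ′ (λ (m , e) → ⊥-elim (w∤n (divides m (sym e)))) (λ ()) (λ ())
        (λ (m , e) → ⊥-elim (w∤n (divides m (sym e))))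

mult↔ : ∀ ws n → Fiber (size ws) n ↔ Fin (coeff ws n)
mult↔ [] zero    = mk↔ₛ′ (λ _ → Fin.zero) (λ _ → tt , refl) (λ { Fin.zero → refl ; (Fin.suc ()) })
                         (λ { (tt , refl) → refl })
mult↔ [] (suc n) = mk↔ₛ′ (λ ()) (λ ()) (λ ()) (λ ())
mult↔ (w ∷ ws) n = ↔-trans split (conv↔ (multiples↔ w) (mult↔ ws) n)
  where
  split : Fiber (size (w ∷ ws)) n ↔ Conv (Fiber (multiples w)) (Fiber (size ws)) n
  split = mk↔ₛ′
    (λ ((m , r) , e) → _ , _ , e , (m , refl) , (r , refl))
    (λ (_ , _ , e , (m , p) , (r , q)) → (m , r) , trans (cong₂ _+_ p q) e)
    (λ { (_ , _ , e , (m , refl) , (r , refl)) → refl })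
    (λ _ → refl)

-- The freedom in `N` lets the recurrence at `n` read all values `pp i` with `i ≤ n` as coefficients
-- of one and the same product.
pp≡coeff : ∀ {n N} → n ≤ N → pp n ≡ coeff (cells N 0 N) n
pp≡coeff {n} {N} n≤N = ↔⇒≡ (↔-trans
  (Composition.inverse (pp-counts n) (Symmetry.inverse (pathsInverse N n≤N)))
  (↔-trans (fiber-cong (paths≃mult N 0 N) n) (mult↔ (cells N 0 N) n)))

σ₂ : ℕ → ℕ
σ₂ k = Σ< k (λ d → suc d * (suc d * χ (suc d) k))

powerSum-++ : ∀ vs ws k → powerSum (vs ++ ws) k ≡ powerSum vs k + powerSum ws k
powerSum-++ []       ws k = refl
powerSum-++ (v ∷ vs) ws k = trans (cong (_+ suc v * χ (suc v) k) (powerSum-++ vs ws k))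
  (lemma (powerSum vs k) (powerSum ws k) (suc v * χ (suc v) k))
  where
  lemma : ∀ a b c → a + b + c ≡ a + c + b
  lemma = solve-∀

module _ (k : ℕ) where

  private
    h : ℕ → ℕ
    h d = suc d * χ (suc d) (suc k)

    h-large : ∀ d → suc k ≤ d → h d ≡ 0
    h-large d k<d = trans (cong (suc d *_) (χ-no (>⇒∤ (s≤s k<d)))) (*-zeroʳ (suc d))

    powerSum-row : ∀ x y → powerSum (row x y) (suc k) ≡ Σ< x (λ i → h (i + y))
    powerSum-row zero    y = refl
    powerSum-row (suc x) y = trans (cong (_+ h (x + y)) (powerSum-row x y))
      (sym (Σ-last x (λ i → h (i + y))))

    -- For d < m ≤ N the value d + y occurs in d + 1 cells, one for each way of writing d as a sum
    -- of a column and a row index. Larger values stand for numbers exceeding `suc k`, which cannot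
    -- divide it. The multiplicity d + 1 later turns a sum of divisors into a sum of their squares.
    powerSum-cells : ∀ {N} y m → m ≤ N → suc k ≤ y + m →
      powerSum (cells N y m) (suc k) ≡ Σ< m (λ d → suc d * h (d + y))
    powerSum-cells     y zero    m≤N large = refl
    powerSum-cells {N} y (suc m) m<N large = begin
      powerSum (row N y ++ cells N (suc y) m) (suc k)
        ≡⟨ powerSum-++ (row N y) (cells N (suc y) m) (suc k) ⟩
      powerSum (row N y) (suc k) + powerSum (cells N (suc y) m) (suc k)
        -- Beyond its first `suc m` terms the row contributes nothing, as `suc (i + y)` is then
        -- larger than `suc k`.
        ≡⟨ cong₂ _+_ (trans (powerSum-row N y) (Σ-support m<N (λ i m<i →
             h-large (i + y) (≤-trans large (≤-trans (≤-reflexive (+-comm y (suc m)))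
                                                     (+-monoˡ-≤ y m<i))))))
             (powerSum-cells (suc y) m (<⇒≤ m<N) (subst (suc k ≤_) (+-suc y m) large)) ⟩
      Σ< (suc m) (λ i → h (i + y)) + Σ< m (λ d → suc d * h (d + suc y))
        ≡⟨ cong (Σ< (suc m) (λ i → h (i + y)) +_)
             (Σ-cong m (λ d _ → cong (λ z → suc d * h z) (+-suc d y))) ⟩
      h y + Σ< m (λ i → h (suc i + y)) + Σ< m (λ d → suc d * h (suc d + y))
        ≡⟨ +-assoc (h y) _ _ ⟩
      h y + (Σ< m (λ i → h (suc i + y)) + Σ< m (λ d → suc d * h (suc d + y)))
        ≡⟨ cong₂ _+_ (sym (*-identityˡ (h y)))
             (sym (Σ-+ m (λ i → h (suc i + y)) (λ d → suc d * h (suc d + y)))) ⟩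
      Σ< (suc m) (λ d → suc d * h (d + y)) ∎
      where open ≡-Reasoning

  powerSum-square : ∀ {N} → suc k ≤ N → powerSum (cells N 0 N) (suc k) ≡ σ₂ (suc k)
  powerSum-square {N} k<N = begin
    powerSum (cells N 0 N) (suc k)          ≡⟨ powerSum-cells 0 N ≤-refl k<N ⟩
    Σ< N (λ d → suc d * h (d + 0))          ≡⟨ Σ-cong N (λ d _ → cong (λ z → suc d * h z) (+-identityʳ d)) ⟩
    Σ< N (λ d → suc d * h d)                ≡⟨ Σ-support k<N (λ d k<d →
                                                 trans (cong (suc d *_) (h-large d k<d)) (*-zeroʳ (suc d))) ⟩
    Σ< (suc k) (λ d → suc d * h d)          ∎
    where open ≡-Reasoning

conv-cong≤ : ∀ {f f′ g g′} n → (∀ {i} → i ≤ n → f i ≡ f′ i) → (∀ {i} → i ≤ n → g i ≡ g′ i) →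
             conv f g n ≡ conv f′ g′ n
conv-cong≤ zero    e e′ = cong₂ _*_ (e z≤n) (e′ z≤n)
conv-cong≤ (suc n) e e′ = cong₂ _+_ (cong₂ _*_ (e z≤n) (e′ ≤-refl))
  (conv-cong≤ n (e ∘ s≤s) (e′ ∘ m≤n⇒m≤1+n))

pp-recurrence : ∀ n → n * pp n ≡ conv σ₂ pp n
pp-recurrence n = begin
  n * pp n                                        ≡⟨ cong (n *_) (pp≡coeff ≤-refl) ⟩
  n * coeff ws n                                      ≡⟨ logarithmic-derivative ws n ⟩
  conv (drop₀ (powerSum ws)) (coeff ws) n             ≡⟨ conv-cong≤ n s≡ (sym ∘ pp≡coeff) ⟩
  conv σ₂ pp n                                    ∎
  where
  open ≡-Reasoning
  ws = cells n 0 n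
  s≡ : ∀ {i} → i ≤ n → drop₀ (powerSum ws) i ≡ σ₂ i
  s≡ {zero}  _   = refl
  s≡ {suc k} k<n = powerSum-square k k<n

pp-zero : pp 0 ≡ 1
pp-zero = trans (pp≡coeff {0} {0} z≤n) refl

-- Strict monotonicity of `pp`

raise : ∀ {n} → PlanePartition n → PlanePartition (suc n)
raise p = record
  { π          = π′
  ; row-weakly = λ { zero zero → m≤n⇒m≤1+n (row-weakly 0 0) ; zero (suc j) → row-weakly 0 (suc j)
                   ; (suc i) j → row-weakly (suc i) j }
  ; col-weakly = λ { zero zero → m≤n⇒m≤1+n (col-weakly 0 0) ; zero (suc j) → col-weakly 0 (suc j)
                   ; (suc i) j → col-weakly (suc i) j }
  -- The bound is positive, so that every box considered contains the raised corner.
  ; has-sum    = suc (proj₁ has-sum) , λ where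
      (suc M) N<M → cong suc (proj₂ has-sum (suc M) (<⇒≤ N<M))
  }
  where
  open PlanePartition p
  π′ : Array
  π′ zero    zero    = suc (π 0 0)
  π′ zero    (suc j) = π 0 (suc j)
  π′ (suc i) j       = π (suc i) j

ones : ∀ n → PlanePartition n
ones n = record
  { π          = π′
  ; row-weakly = λ { zero j → decreasing n j ; (suc i) j → z≤n }
  ; col-weakly = λ _ _ → z≤n
  ; has-sum    = suc n , λ where
      (suc M) (s≤s n≤M) → trans (cong₂ _+_ (total n (m≤n⇒m≤1+n n≤M)) (Σ-zero M (λ i → Σ-zero M (λ _ → refl))))
                                (+-identityʳ n)
  }
  where
  ones-row : ℕ → ℕ → ℕ
  ones-row zero    j       = 0
  ones-row (suc n) zero    = 1
  ones-row (suc n) (suc j) = ones-row n j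
  decreasing : ∀ n j → ones-row n (suc j) ≤ ones-row n j
  decreasing zero          j       = z≤n
  decreasing (suc zero)    zero    = z≤n
  decreasing (suc (suc n)) zero    = ≤-refl
  decreasing (suc n)       (suc j) = decreasing n j
  total : ∀ n {M} → n ≤ M → Σ< M (ones-row n) ≡ n
  total zero    {M} _         = Σ-zero M (λ _ → refl)
  total (suc n) (s≤s n≤M) = cong suc (total n n≤M)
  π′ : Array
  π′ zero    j = ones-row n j
  π′ (suc i) j = 0

ones-second : ∀ {n} → 1 ≤ n → PlanePartition.π (ones (suc n)) 0 1 ≡ 1
ones-second (s≤s _) = refl

module _ (n : ℕ) where

  private
    module I = Inverse (pp-counts n)
    module J = Inverse (pp-counts (suc n))

    f : Fin (pp n) → Fin (pp (suc n))
    f k = J.from (raise (I.to k))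

    open PlanePartition

    array-raise : ∀ k i j → π (J.to (f k)) i j ≡ π (raise (I.to k)) i j
    array-raise k = J.strictlyInverseˡ (raise (I.to k))

    lower≡ : ∀ (p q : PlanePartition n) → (∀ i j → π (raise p) i j ≡ π (raise q) i j) →
             ∀ i j → π p i j ≡ π q i j
    lower≡ p q e zero    zero    = suc-injective (e 0 0)
    lower≡ p q e zero    (suc j) = e 0 (suc j)
    lower≡ p q e (suc i) j       = e (suc i) j

    f-injective : ∀ {k l} → f k ≡ f l → k ≡ l
    f-injective {k} {l} e = trans (sym (I.strictlyInverseʳ k)) (trans
      (I.from-cong (lower≡ (I.to k) (I.to l) λ i j → trans (sym (array-raise k i j))
        (trans (cong (λ x → π (J.to x) i j) e) (array-raise l i j))))
      (I.strictlyInverseʳ l))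

  pp-suc-≤ : pp n ≤ pp (suc n)
  pp-suc-≤ = injective⇒≤ f-injective

  -- A single row of ones is missed by raising the corner, unless n = 0.
  pp-suc-< : 1 ≤ n → pp n < pp (suc n)
  pp-suc-< 1≤n = injective⇒≤ g-injective
    where
    g : Fin (suc (pp n)) → Fin (pp (suc n))
    g Fin.zero    = J.from (ones (suc n))
    g (Fin.suc k) = f k
    -- In a raised array the corner exceeds its right neighbour, whereas a row of at least two ones
    -- has equal entries there.
    missed : ∀ k → ¬ J.from (ones (suc n)) ≡ f k
    missed k e = <⇒≱ (≤-reflexive (trans (sym (ones-second 1≤n)) (sym (e′ 0 1))))
      (≤-trans (row-weakly (I.to k) 0 0) (≤-reflexive (suc-injective (e′ 0 0))))
      where
      e′ : ∀ i j → π (raise (I.to k)) i j ≡ π (ones (suc n)) i j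
      e′ i j = trans (sym (array-raise k i j)) (trans (cong (λ x → π (J.to x) i j) (sym e))
        (J.strictlyInverseˡ (ones (suc n)) i j))
    g-injective : ∀ {k l} → g k ≡ g l → k ≡ l
    g-injective {Fin.zero}  {Fin.zero}  e = refl
    g-injective {Fin.zero}  {Fin.suc l} e = contradiction e (missed l)
    g-injective {Fin.suc k} {Fin.zero}  e = contradiction (sym e) (missed k)
    g-injective {Fin.suc k} {Fin.suc l} e = cong Fin.suc (f-injective e)

-- Values and growth of pp

Σ-≤ : ∀ N {f : ℕ → ℕ} {c} → (∀ i → i < N → f i ≤ c) → Σ< N f ≤ N * c
Σ-≤ zero    h = z≤n
Σ-≤ (suc N) h = +-mono-≤ (h 0 z<s) (Σ-≤ N (λ i → h (suc i) ∘ s<s))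

conv-≤ : ∀ f g X n → (∀ i → i ≤ n → f i ≤ X) → conv f g n ≤ X * Σ< (suc n) g
conv-≤ f g X zero    h = ≤-trans (*-monoˡ-≤ (g 0) (h 0 z≤n))
  (≤-reflexive (cong (X *_) (sym (+-identityʳ (g 0)))))
conv-≤ f g X (suc n) h = begin
  f 0 * g (suc n) + conv (f ∘ suc) g n  ≤⟨ +-mono-≤ (*-monoˡ-≤ (g (suc n)) (h 0 z≤n))
                                             (conv-≤ (f ∘ suc) g X n (λ i → h (suc i) ∘ s≤s)) ⟩
  X * g (suc n) + X * Σ< (suc n) g      ≡⟨ *-distribˡ-+ X (g (suc n)) _ ⟨
  X * (g (suc n) + Σ< (suc n) g)        ≡⟨ cong (X *_) (+-comm (g (suc n)) _) ⟩
  X * (Σ< (suc n) g + g (suc n))        ≡⟨ cong (X *_) (Σ-last (suc n) g) ⟨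
  X * Σ< (suc (suc n)) g                ∎
  where open ≤-Reasoning

conv-≥ : ∀ f g X n → (∀ i → X ≤ g i) → X * Σ< (suc n) f ≤ conv f g n
conv-≥ f g X zero    h = begin
  X * (f 0 + 0) ≡⟨ trans (cong (X *_) (+-identityʳ (f 0))) (*-comm X (f 0)) ⟩
  f 0 * X       ≤⟨ *-monoʳ-≤ (f 0) (h 0) ⟩
  f 0 * g 0     ∎
  where open ≤-Reasoning
conv-≥ f g X (suc n) h = begin
  X * (f 0 + Σ< (suc n) (f ∘ suc))       ≡⟨ *-distribˡ-+ X (f 0) _ ⟩
  X * f 0 + X * Σ< (suc n) (f ∘ suc)     ≤⟨ +-mono-≤ (≤-trans (≤-reflexive (*-comm X (f 0)))
                                               (*-monoʳ-≤ (f 0) (h (suc n))))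
                                              (conv-≥ (f ∘ suc) g X n h) ⟩
  f 0 * g (suc n) + conv (f ∘ suc) g n   ∎
  where open ≤-Reasoning

pp-mono : ∀ {m n} → m ≤ n → pp m ≤ pp n
pp-mono m≤n = go (≤⇒≤′ m≤n)
  where
  go : ∀ {m n} → m ≤′ n → pp m ≤ pp n
  go ≤′-refl       = ≤-refl
  go (≤′-step m≤n) = ≤-trans (go m≤n) (pp-suc-≤ _)

pp-positive : ∀ n → 1 ≤ pp n
pp-positive n = ≤-trans (≤-reflexive (sym pp-zero)) (pp-mono {0} {n} z≤n)

dot : (ℕ → ℕ) → List ℕ → ℕ
dot f []       = 0
dot f (x ∷ xs) = f 0 * x + dot (f ∘ suc) xs

-- The values are in descending order of the argument, so that a convolution with `pp` becomes an
-- inner product.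
ppList : ℕ → List ℕ
ppList zero    = pp 0 ∷ []
ppList (suc n) = pp (suc n) ∷ ppList n

conv-dot : ∀ f n → conv f pp n ≡ dot f (ppList n)
conv-dot f zero    = sym (+-identityʳ _)
conv-dot f (suc n) = cong (f 0 * pp (suc n) +_) (conv-dot (f ∘ suc) n)

-- A separate function, so that evaluation shares the previous table.
next : ℕ → List ℕ → List ℕ
next n ps = dot (σ₂ ∘ suc) ps / suc n ∷ ps

table : ℕ → List ℕ
table zero    = 1 ∷ []
table (suc n) = next n (table n)

ppList≡table : ∀ n → ppList n ≡ table n
ppList≡table zero    = cong (_∷ []) pp-zero
ppList≡table (suc n) = trans (cong (_∷ ppList n) pp≡) (cong (next n) (ppList≡table n))
  where
  pp≡ : pp (suc n) ≡ dot (σ₂ ∘ suc) (ppList n) / suc n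
  pp≡ = begin
    pp (suc n)                            ≡⟨ m*n/n≡m (pp (suc n)) (suc n) ⟨
    pp (suc n) * suc n / suc n            ≡⟨ cong (_/ suc n) (*-comm (pp (suc n)) (suc n)) ⟩
    suc n * pp (suc n) / suc n            ≡⟨ cong (_/ suc n) (pp-recurrence (suc n)) ⟩
    -- The term with `pp (suc n)` itself has disappeared by computation, because `σ₂ 0` is 0.
    conv (σ₂ ∘ suc) pp n / suc n          ≡⟨ cong (_/ suc n) (conv-dot (σ₂ ∘ suc) n) ⟩
    dot (σ₂ ∘ suc) (ppList n) / suc n     ∎
    where open ≡-Reasoning

known : List ℕ
known =
  225863047430 ∷ 161825846160 ∷ 115737404664 ∷ 82623976486 ∷ 58874385349 ∷ 41871334614 ∷
  29720561230 ∷ 21053676445 ∷ 14883573114 ∷ 10499640707 ∷ 7391026522 ∷ 5191304973 ∷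
  3637993036 ∷ 2543535902 ∷ 1774079109 ∷ 1234363833 ∷ 856667495 ∷ 593001267 ∷ 409383981 ∷
  281846923 ∷ 193487501 ∷ 132441995 ∷ 90379784 ∷ 61484961 ∷ 41691046 ∷ 28175955 ∷
  18974973 ∷ 12733429 ∷ 8512309 ∷ 5668963 ∷ 3759612 ∷ 2483234 ∷ 1632658 ∷ 1068745 ∷
  696033 ∷ 451194 ∷ 290783 ∷ 186475 ∷ 118794 ∷ 75278 ∷ 47330 ∷ 29601 ∷ 18334 ∷ 11297 ∷
  6879 ∷ 4167 ∷ 2485 ∷ 1479 ∷ 859 ∷ 500 ∷ 282 ∷ 160 ∷ 86 ∷ 48 ∷ 24 ∷ 13 ∷ 6 ∷ 3 ∷ 1 ∷ 1 ∷ []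

-- Type checking evaluates `table 59` here and compares it with the literals; the finite checks
-- below only look values up.
ppList≡known : ppList 59 ≡ known
ppList≡known = ppList≡table 59

nth : List ℕ → ℕ → ℕ
nth []       i       = 0
nth (x ∷ xs) zero    = x
nth (x ∷ xs) (suc i) = nth xs i

ppList-nth : ∀ n i → i ≤ n → nth (ppList n) (n ∸ i) ≡ pp i
ppList-nth zero    zero    _   = refl
ppList-nth (suc n) i       i≤n with m≤n⇒m<n∨m≡n i≤n
... | inj₁ (s≤s i≤n′) = trans (cong (nth (ppList (suc n))) (+-∸-assoc 1 i≤n′)) (ppList-nth n i i≤n′)
... | inj₂ refl       = cong (nth (ppList (suc n))) (n∸n≡0 n)

q : ℕ → ℕ
q i = nth known (59 ∸ i)

pp≡q : ∀ {i} → i < 60 → pp i ≡ q i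
pp≡q {i} (s≤s i≤59) = trans (sym (ppList-nth 59 i i≤59))
  (cong (λ ps → nth ps (59 ∸ i)) ppList≡known)

q-submultiplicative : ∀ {a} → a < 30 → ∀ {b} → b < 30 →
                      2 ≤ a → 2 ≤ b → 12 ≤ a + b → q (a + b) < q a * q b
q-submultiplicative = from-yes (allUpTo? (λ a → allUpTo? (λ b →
  2 ≤? a →-dec 2 ≤? b →-dec 12 ≤? a + b →-dec q (a + b) <? q a * q b) 30) 30)

-- Meant for the pairs with `a + b < 12`: both arguments are at least 2, so both are below 10.
q-≢ : ∀ {a} → a < 10 → ∀ {b} → b < 10 → 2 ≤ a → 2 ≤ b → ¬ q a * q b ≡ q (a + b)
q-≢ = from-yes (allUpTo? (λ a → allUpTo? (λ b →
  2 ≤? a →-dec 2 ≤? b →-dec ¬? (q a * q b ≟ q (a + b))) 10) 10)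

-- The tightest case is b = 2, where the defects add up to 109 and the bound is 120.
q-defect : ∀ {b} → b < 11 → 2 ≤ b → Σ< 12 (λ i → q (i + b) ∸ q i * q b) ≤ 20 * (b * q b)
q-defect = from-yes (allUpTo? (λ b →
  2 ≤? b →-dec Σ< 12 (λ i → q (i + b) ∸ q i * q b) ≤? 20 * (b * q b)) 11)

cube : ℕ → ℕ
cube n = n * (n * n)

q-growth : ∀ {n} → n < 60 → 30 ≤ n → 168 * cube (suc n) < q n
q-growth = from-yes (allUpTo? (λ n → 30 ≤? n →-dec 168 * cube (suc n) <? q n) 60)

σ₂-≤ : ∀ k → σ₂ k ≤ cube k
σ₂-≤ k = Σ-≤ k λ d d<k → *-mono-≤ d<k
  (≤-trans (*-mono-≤ d<k (χ≤1 (suc d) k)) (≤-reflexive (*-identityʳ k)))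

σ₂-≥ : ∀ k → k * k ≤ σ₂ k
σ₂-≥ zero    = z≤n
σ₂-≥ (suc k) = begin
  suc k * suc k                           ≡⟨ cong (suc k *_) (*-identityʳ (suc k)) ⟨
  suc k * (suc k * 1)                     ≡⟨ cong (λ z → suc k * (suc k * z)) (χ-yes {suc k} ∣-refl) ⟨
  suc k * (suc k * χ (suc k) (suc k))     ≤⟨ Σ-term (λ d → suc d * (suc d * χ (suc d) (suc k))) (n<1+n k) ⟩
  σ₂ (suc k)                              ∎
  where open ≤-Reasoning

-- The factor 16 is what `pp-double` needs, where 2m · 8 pp(m) appears. Each further term is at
-- least a square (11 + k)² ≥ 4 · 4.
σ₂-sum : ∀ k → 16 * (10 + k) ≤ Σ< (11 + k) σ₂
σ₂-sum zero    = from-yes (160 ≤? Σ< 11 σ₂)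
σ₂-sum (suc k) = begin
  16 * (11 + k)                  ≡⟨ *-suc 16 (10 + k) ⟩
  16 + 16 * (10 + k)             ≤⟨ +-mono-≤ (≤-trans (*-mono-≤ {4} (m≤n⇒m≤n+o k (m≤m+n 4 7)) (m≤n⇒m≤n+o k (m≤m+n 4 7)))
                                               (σ₂-≥ (11 + k))) (σ₂-sum k) ⟩
  σ₂ (11 + k) + Σ< (11 + k) σ₂   ≡⟨ +-comm (σ₂ (11 + k)) _ ⟩
  Σ< (11 + k) σ₂ + σ₂ (11 + k)   ≡⟨ Σ-last (11 + k) σ₂ ⟨
  Σ< (12 + k) σ₂                 ∎
  where open ≤-Reasoning

-- Keeping only the terms pp (2m - k) ≥ pp m of the recurrence for pp (2m).
pp-double : ∀ k → let m = 10 + k in 8 * pp m ≤ pp (m + m)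
pp-double k = *-cancelˡ-≤ (m + m) (begin
  (m + m) * (8 * pp m)                                 ≡⟨ rearrange m (pp m) ⟩
  pp m * (16 * m)                                      ≤⟨ *-monoʳ-≤ (pp m) (σ₂-sum k) ⟩
  pp m * Σ< (suc m) σ₂                                 ≤⟨ conv-≥ σ₂ (λ i → pp (i + m)) (pp m) m
                                                            (λ i → pp-mono (m≤n+m m i)) ⟩
  conv σ₂ (λ i → pp (i + m)) m                         ≤⟨ m≤m+n _ _ ⟩
  conv σ₂ (λ i → pp (i + m)) m
    + conv (λ j → σ₂ (suc (m + j))) pp (9 + k)         ≡⟨ conv-split σ₂ pp m (9 + k) ⟨
  conv σ₂ pp (m + m)                                   ≡⟨ pp-recurrence (m + m) ⟨
  (m + m) * pp (m + m)                                 ∎)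
  where
  open ≤-Reasoning
  m = 10 + k
  rearrange : ∀ m p → (m + m) * (8 * p) ≡ p * (16 * m)
  rearrange = solve-∀

data Half : ℕ → Set where
  even : ∀ m → Half (m + m)
  odd  : ∀ m → Half (suc (m + m))

halve : ∀ n → Half n
halve zero    = even 0
halve (suc n) with halve n
... | even m = odd m
... | odd m  = subst Half (cong suc (+-suc m m)) (even (suc m))

cube-mono : ∀ {m n} → m ≤ n → cube m ≤ cube n
cube-mono m≤n = *-mono-≤ m≤n (*-mono-≤ m≤n m≤n)

pp-growth : ∀ n → 30 ≤ n → 168 * cube (suc n) < pp n
pp-growth n 30≤n = go (suc n) n ≤-refl 30≤n
  where
  open ≤-Reasoning
  go : ∀ f n → n < f → 30 ≤ n → 168 * cube (suc n) < pp n
  -- The bound belonging to 2m + 1 is proved already at 2m, which serves both parities. It is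
  -- exactly 8 times the bound at m, since 2m + 2 = 2 (m + 1); this is why the growth bound uses the
  -- cube of n + 1.
  doubled : ∀ f m → m < f → 30 ≤ m → 168 * cube (suc (suc (m + m))) < pp (m + m)
  doubled f m m<f 30≤m = begin-strict
    168 * cube (suc (suc (m + m)))   ≡⟨ rearrange m ⟩
    8 * (168 * cube (suc m))         <⟨ *-monoʳ-< 8 (go f m m<f 30≤m) ⟩
    8 * pp m                         ≤⟨ subst (λ m → 8 * pp m ≤ pp (m + m))
                                          (m+[n∸m]≡n (≤-trans (m≤m+n 10 20) 30≤m)) (pp-double (m ∸ 10)) ⟩
    pp (m + m)                       ∎
    where
    rearrange : ∀ m → 168 * ((2 + (m + m)) * ((2 + (m + m)) * (2 + (m + m)))) ≡
                      8 * (168 * ((1 + m) * ((1 + m) * (1 + m))))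
    rearrange = solve-∀
  go (suc f) n (s≤s n≤f) 30≤n with n <? 60
  ... | yes n<60 = subst (168 * cube (suc n) <_) (sym (pp≡q n<60)) (q-growth n<60 30≤n)
  ... | no  n≮60 with halve n
  ...   | even m = ≤-<-trans (*-monoʳ-≤ 168 (cube-mono (n≤1+n (suc (m + m)))))
                     (doubled f m (≤-trans (m<m+n m (≤-trans z<s 30≤m)) n≤f) 30≤m)
    where
    30≤m : 30 ≤ m
    30≤m = ≮⇒≥ λ m<30 → n≮60 (+-mono-< m<30 m<30)
  ...   | odd m  = <-≤-trans (doubled f m (≤-trans (s≤s (m≤m+n m m)) n≤f) 30≤m) (pp-suc-≤ (m + m))
    where
    30≤m : 30 ≤ m
    30≤m = ≮⇒≥ λ m<30 → n≮60 (s≤s (s≤s (+-mono-≤ (s≤s⁻¹ m<30) (s≤s⁻¹ m<30))))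

-- The inequality

Submultiplicative : ℕ → ℕ → Set
Submultiplicative a b = 2 ≤ a → 2 ≤ b → 12 ≤ a + b → pp (a + b) < pp a * pp b

defect : ℕ → ℕ → ℕ
defect b i = pp (i + b) ∸ pp i * pp b

Σ-vanish : ∀ N (f : ℕ → ℕ) → (∀ i → i < N → f i ≡ 0) → Σ< N f ≡ 0
Σ-vanish N f e = trans (Σ-cong N e) (Σ-zero N (λ _ → refl))

module _ {a b} (b≤a : b ≤ a) (30≤a : 30 ≤ a) (2≤b : 2 ≤ b)
         (IH : ∀ i j → i + j < a + b → Submultiplicative i j) where

  defect-vanishes : ∀ i → i < a → 2 ≤ i → 12 ≤ i + b → defect b i ≡ 0
  defect-vanishes i i<a 2≤i 12≤ = m≤n⇒m∸n≡0 (<⇒≤ (IH i b (+-monoˡ-< b i<a) 2≤i 2≤b 12≤))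

  -- For `b < 11` the induction hypothesis disposes of all `i ≥ 12`, and the remaining defects are
  -- known values. For larger `b` it disposes of all `i ≥ 2`, and `pp 0 ≡ 1` of `i = 0`, so that
  -- only `i = 1` is left.
  Σ-defect : Σ< a (defect b) ≤ 20 * (b * pp b)
  Σ-defect with b <? 11
  ... | yes b<11 = begin
    Σ< a (defect b)               ≡⟨ cong (λ a → Σ< a (defect b)) 12+k≡a ⟨
    Σ< (12 + k) (defect b)        ≡⟨ Σ-++ 12 k (defect b) ⟩
    Σ< 12 (defect b) + Σ< k (λ i → defect b (12 + i))
      ≡⟨ cong (Σ< 12 (defect b) +_) (Σ-vanish k (λ i → defect b (12 + i)) λ i i<k →
           defect-vanishes (12 + i) (subst (12 + i <_) 12+k≡a (+-monoʳ-< 12 i<k))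
             (m≤m+n 2 _) (m≤m+n 12 _)) ⟩
    Σ< 12 (defect b) + 0          ≡⟨ +-identityʳ _ ⟩
    Σ< 12 (defect b)
      ≡⟨ Σ-cong 12 (λ i i<12 → cong₂ _∸_
           (pp≡q (≤-trans (+-mono-<-≤ i<12 (<⇒≤ b<11)) (m≤m+n 23 37)))
           (cong₂ _*_ (pp≡q (≤-trans i<12 (m≤m+n 12 48))) (pp≡q b<60))) ⟩
    Σ< 12 (λ i → q (i + b) ∸ q i * q b) ≤⟨ q-defect b<11 2≤b ⟩
    20 * (b * q b)                ≡⟨ cong (λ z → 20 * (b * z)) (pp≡q b<60) ⟨
    20 * (b * pp b)               ∎
    where
    open ≤-Reasoning
    k = a ∸ 12
    12+k≡a : 12 + k ≡ a
    12+k≡a = m+[n∸m]≡n (≤-trans (m≤m+n 12 18) 30≤a)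
    b<60 : b < 60
    b<60 = ≤-trans b<11 (m≤m+n 11 49)
  ... | no b≮11 = begin
    Σ< a (defect b)               ≡⟨ cong (λ a → Σ< a (defect b)) 2+k≡a ⟨
    defect b 0 + (defect b 1 + Σ< k (λ i → defect b (2 + i)))
      ≡⟨ cong₂ (λ x y → x + (defect b 1 + y)) defect₀
           (Σ-vanish k (λ i → defect b (2 + i)) λ i i<k →
             defect-vanishes (2 + i) (subst (2 + i <_) 2+k≡a (+-monoʳ-< 2 i<k))
               (m≤m+n 2 _) (≤-trans (s≤s 11≤b) (s≤s (≤-trans (n≤1+n b) (s≤s (m≤n+m b i)))))) ⟩
    defect b 1 + 0                ≡⟨ +-identityʳ _ ⟩
    defect b 1                    ≤⟨ m∸n≤m (pp (1 + b)) (pp 1 * pp b) ⟩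
    pp (1 + b)                    ≤⟨ pp-next b 11≤b 2≤b (+-monoˡ-< b (≤-trans (m≤m+n 2 28) 30≤a)) ⟩
    3 * pp b                      ≤⟨ *-mono-≤ (m≤m+n 3 17) (m≤n*m (pp b) b) ⟩
    20 * (b * pp b)               ∎
    where
    open ≤-Reasoning
    instance _ = >-nonZero (≤-trans (s≤s z≤n) 2≤b)
    k = a ∸ 2
    2+k≡a : 2 + k ≡ a
    2+k≡a = m+[n∸m]≡n (≤-trans (m≤m+n 2 28) 30≤a)
    11≤b : 11 ≤ b
    11≤b = ≮⇒≥ b≮11
    defect₀ : defect b 0 ≡ 0
    defect₀ = m≤n⇒m∸n≡0 (≤-reflexive (sym (trans (cong (_* pp b) pp-zero) (*-identityˡ (pp b)))))
    -- The trick is to write 1 + b as 2 + c with c = b - 1 and to apply the induction hypothesis to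
    -- 2 and c. It requires 2 + c ≥ 12, which explains the split at 11.
    pp-next : ∀ b′ → 11 ≤ b′ → 2 ≤ b′ → suc b′ < a + b → pp (suc b′) ≤ 3 * pp b′
    pp-next (suc c) (s≤s 10≤c) _ small = begin
      pp (2 + c)     ≤⟨ <⇒≤ (IH 2 c small ≤-refl (≤-trans (m≤m+n 2 8) 10≤c) (s≤s (s≤s 10≤c))) ⟩
      pp 2 * pp c    ≡⟨ cong (_* pp c) (pp≡q {2} (m≤m+n 3 57)) ⟩
      3 * pp c       ≤⟨ *-monoʳ-≤ 3 (pp-suc-≤ c) ⟩
      3 * pp (suc c) ∎

module _ {a′ b′} (b≤a : suc b′ ≤ suc a′) (30≤a : 30 ≤ suc a′) (2≤b : 2 ≤ suc b′)
         (IH : ∀ i j → i + j < suc a′ + suc b′ → Submultiplicative i j) where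

  private
    a = suc a′
    b = suc b′
    X = cube (a + a)

    σ₂≤X : ∀ {k} → k ≤ a + b → σ₂ k ≤ X
    σ₂≤X {k} k≤ = ≤-trans (σ₂-≤ k) (cube-mono (≤-trans k≤ (+-monoʳ-≤ a b≤a)))

  -- The two sums are the terms k ≤ a and k > a of the recurrence for pp (a + b).
  submultiplicative-step : pp (a + b) < pp a * pp b
  submultiplicative-step = *-cancelˡ-< (a + b) _ _ (begin-strict
    (a + b) * pp (a + b)                       ≡⟨ pp-recurrence (a + b) ⟩
    conv σ₂ pp (a + b)                         ≡⟨ conv-split σ₂ pp a b′ ⟩
    conv σ₂ (λ i → pp (i + b)) a + conv (λ j → σ₂ (suc (a + j))) pp b′
      ≤⟨ +-mono-≤ head-≤ tail-≤ ⟩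
    a * pp a * pp b + X * (20 * (b * pp b)) + X * (b * pp b)
      ≡⟨ rearrange (a * pp a * pp b) X (b * pp b) ⟩
    a * pp a * pp b + 21 * X * (b * pp b)
      <⟨ +-monoʳ-< (a * pp a * pp b) (*-monoˡ-< (b * pp b) 21X<pp) ⟩
    a * pp a * pp b + pp a * (b * pp b)        ≡⟨ collect a b (pp a) (pp b) ⟩
    (a + b) * (pp a * pp b)                    ∎)
    where
    open ≤-Reasoning
    instance _ = >-nonZero (*-mono-≤ {1} {b} (s≤s z≤n) (pp-positive b))

    head-≤ : conv σ₂ (λ i → pp (i + b)) a ≤ a * pp a * pp b + X * (20 * (b * pp b))
    head-≤ = begin
      conv σ₂ (λ i → pp (i + b)) a
        ≤⟨ conv-monoʳ σ₂ a (λ {i} _ → m≤n+m∸n (pp (i + b)) (pp i * pp b)) ⟩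
      conv σ₂ (λ i → pp i * pp b + defect b i) a
        ≡⟨ conv-+ʳ σ₂ (λ i → pp i * pp b) (defect b) a ⟩
      conv σ₂ (λ i → pp i * pp b) a + conv σ₂ (defect b) a
        -- Once `pp b` is factored out, the recurrence for `pp a` evaluates the main sum exactly.
        ≡⟨ cong (_+ conv σ₂ (defect b) a) (trans (conv-*ʳ (pp b) σ₂ pp a)
             (cong (_* pp b) (sym (pp-recurrence a)))) ⟩
      -- Passing to `σ₂ ∘ suc` removes the defect at `i = a`, whose coefficient is `σ₂ 0`. The
      -- induction hypothesis could not bound it, as it concerns the pair `a`, `b` itself.
      a * pp a * pp b + conv (σ₂ ∘ suc) (defect b) a′
        ≤⟨ +-monoʳ-≤ (a * pp a * pp b) (≤-trans
             (conv-≤ (σ₂ ∘ suc) (defect b) X a′ (λ i i≤a′ → σ₂≤X (≤-trans (s≤s i≤a′) (m≤m+n a b))))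
             (*-monoʳ-≤ X (Σ-defect b≤a 30≤a 2≤b IH))) ⟩
      a * pp a * pp b + X * (20 * (b * pp b)) ∎

    tail-≤ : conv (λ j → σ₂ (suc (a + j))) pp b′ ≤ X * (b * pp b)
    tail-≤ = ≤-trans
      (conv-≤ (λ j → σ₂ (suc (a + j))) pp X b′ (λ j j≤b′ →
        σ₂≤X (≤-trans (≤-reflexive (sym (+-suc a j))) (+-monoʳ-≤ a (s≤s j≤b′)))))
      (*-monoʳ-≤ X (Σ-≤ b (λ i i<b → pp-mono (<⇒≤ i<b))))

    21X<pp : 21 * X < pp a
    21X<pp = ≤-<-trans (≤-trans (≤-reflexive (octuple a)) (*-monoʳ-≤ 168 (cube-mono (n≤1+n a))))
                       (pp-growth a 30≤a)
      where
      octuple : ∀ a → 21 * ((a + a) * ((a + a) * (a + a))) ≡ 168 * (a * (a * a))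
      octuple = solve-∀

    rearrange : ∀ u X v → u + X * (20 * v) + X * v ≡ u + 21 * X * v
    rearrange = solve-∀

    collect : ∀ a b x y → a * x * y + x * (b * y) ≡ (a + b) * (x * y)
    collect = solve-∀

submultiplicative : ∀ a b → Submultiplicative a b
submultiplicative a b = go (suc (a + b)) a b ≤-refl
  where
  go : ∀ n a b → a + b < n → Submultiplicative a b
  ordered : ∀ n a b → a + b ≤ n → b ≤ a → Submultiplicative a b
  ordered n a b a+b≤n b≤a 2≤a 2≤b 12≤a+b with a <? 30
  ... | yes a<30 = subst₂ _<_
          (sym (pp≡q (+-mono-<-≤ a<30 (<⇒≤ b<30))))
          (sym (cong₂ _*_ (pp≡q (≤-trans a<30 (m≤m+n 30 30))) (pp≡q (≤-trans b<30 (m≤m+n 30 30)))))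
          (q-submultiplicative a<30 b<30 2≤a 2≤b 12≤a+b)
    where
    b<30 : b < 30
    b<30 = ≤-<-trans b≤a a<30
  ordered n (suc a) (suc b) a+b≤n b≤a 2≤a 2≤b 12≤a+b | no a≮30 =
    submultiplicative-step b≤a (≮⇒≥ a≮30) 2≤b (λ i j i+j< → go n i j (≤-trans i+j< a+b≤n))
  go (suc n) a b (s≤s a+b≤n) 2≤a 2≤b 12≤a+b with ≤-total a b
  ... | inj₂ b≤a = ordered n a b a+b≤n b≤a 2≤a 2≤b 12≤a+b
  ... | inj₁ a≤b = subst₂ _<_ (cong pp (+-comm b a)) (*-comm (pp b) (pp a))
        (ordered n b a (subst (_≤ n) (+-comm a b) a+b≤n) a≤b 2≤b 2≤a
          (subst (12 ≤_) (+-comm a b) 12≤a+b))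

-- Since `pp 1` is 1, equality would contradict the strict growth of `pp`.
pp-1+-≢ : ∀ b → 1 ≤ b → ¬ pp 1 * pp b ≡ pp (1 + b)
pp-1+-≢ b 1≤b e = <⇒≢ (pp-suc-< b 1≤b)
  (trans (sym (trans (cong (_* pp b) (pp≡q {1} (m≤m+n 2 58))) (*-identityˡ (pp b)))) e)

pp-≢ : ∀ a b → 1 ≤ a → 1 ≤ b → ¬ pp a * pp b ≡ pp (a + b)
pp-≢ (suc zero)    b             1≤a 1≤b e = pp-1+-≢ b 1≤b e
pp-≢ (suc (suc a)) (suc zero)    1≤a 1≤b e = pp-1+-≢ (2 + a) (s≤s z≤n)
  (trans (*-comm (pp 1) (pp (2 + a))) (trans e (cong pp (+-comm (2 + a) 1))))
pp-≢ (suc (suc a)) (suc (suc b)) 1≤a 1≤b e with 12 ≤? (2 + a) + (2 + b)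
... | yes 12≤ = <⇒≢ (submultiplicative (2 + a) (2 + b) (m≤m+n 2 a) (m≤m+n 2 b) 12≤) (sym e)
... | no  12≰ = q-≢ a<10 b<10 (m≤m+n 2 a) (m≤m+n 2 b)
      (trans (sym (cong₂ _*_ (pp≡q (≤-trans a<10 (m≤m+n 10 50))) (pp≡q (≤-trans b<10 (m≤m+n 10 50)))))
             (trans e (pp≡q (≤-trans (≰⇒> 12≰) (m≤m+n 12 48)))))
  where
  a<10 : 2 + a < 10
  a<10 = +-cancelʳ-≤ 2 _ _ (≤-trans (s≤s (+-monoʳ-≤ (2 + a) (m≤m+n 2 b))) (≰⇒> 12≰))
  b<10 : 2 + b < 10
  b<10 = +-cancelˡ-≤ 2 _ _ (≤-trans (≤-reflexive (+-suc 2 (2 + b))) (≤-trans (s≤s (+-monoˡ-≤ (2 + b) (m≤m+n 2 a))) (≰⇒> 12≰)))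

theorem1p1 : ∀ (a b : ℕ) → 1 ≤ a → 1 ≤ b →
    (2 ≤ a → 2 ≤ b → 12 ≤ a + b → pp a * pp b > pp (a + b))
    × ¬ (pp a * pp b ≡ pp (a + b))
theorem1p1 a b 1≤a 1≤b = submultiplicative a b , pp-≢ a b 1≤a 1≤b
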